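{- Let $n,m_1,m_2$ be nonnegative integers. Let $B_1(m_1,m_2,n)$ be the number of partitions of $n$ into parts congruent to $0,2,3,$ or $4\pmod 6$ having exactly $m_1$ parts congruent to $2\pmod 6$ and exactly $m_2$ parts congruent to $4\pmod 6$. Let $B_2(m_1,m_2,n)$ be the number of partitions of $n$ in which no two consecutive integers both appear as parts and all parts are at least $2$, having exactly $m_2$ parts congruent to $1\pmod 3$ and exactly $m_1$ parts congruent to $2\pmod 3$. Then $B_1(m_1,m_2,n)=B_2(m_1,m_2,n)$. Equivalently, if $\Lambda$ denotes the set of partitions with no part equal to $1$ in which no two consecutive integers both appear as parts, and $\#_{1,3}(\lambda)$, $\#_{2,3}(\lambda)$ denote the numbers of parts of $\lambda$ congruent to $1$ and $2\pmod 3$ respectively (counted with multiplicity), then as formal power series $$\sum_{\lambda\in\Lambda}A^{\#_{2,3}(\lambda)}C^{\#_{1,3}(\lambda)}q^{|\lambda|}=\frac{1}{(q^3;q^3)_\infty\,(Aq^2;q^6)_\infty\,(Cq^4;q^6)_\infty}.$$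
   Context: $|\lambda|$ is the sum of the parts of $\lambda$. Standard $q$-Pochhammer notation: $(a;q)_\infty=\prod_{j\ge0}(1-aq^j)$. Numbers of parts in a given residue class are counted with multiplicity. -}

module Defs where

open import Algebra.Bundles.Raw using (RawRing)
import Algebra.Definitions.RawMonoid as RawMonoidDefs
import Algebra.Definitions.RawSemiring as RawSemiringDefs
open import Data.Fin.Base using (toℕ)
open import Data.Integer.Base using (+-*-rawRing)
open import Data.List.Base using (List; []; _∷_; [_]; concatMap; filter; foldr; length; map; upTo)
open import Data.List.Membership.Propositional using (_∈_; _∉_; find; lose)
open import Data.List.Membership.Propositional.Properties
  using (∈-concatMap⁺; ∈-concatMap⁻; ∈-map⁺; ∈-map⁻; ∈-upTo⁺; ∈-upTo⁻)
open import Data.List.Properties using (∷-injectiveʳ)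
open import Data.List.Relation.Binary.Disjoint.Propositional using (Disjoint)
open import Data.List.Relation.Unary.All as All using (All; []; _∷_)
import Data.List.Relation.Unary.All.Properties as All
open import Data.List.Relation.Unary.AllPairs as AllPairs using (AllPairs; []; _∷_)
import Data.List.Relation.Unary.AllPairs.Properties as AllPairs
open import Data.List.Relation.Unary.Any using (here; there)
open import Data.List.Relation.Unary.Unique.Propositional using (Unique)
import Data.List.Relation.Unary.Unique.Propositional.Properties as Unique
open import Data.Nat.Base as ℕ using (ℕ; zero; suc; _∸_; _⊓_; _≤_; _≥_; z≤n; s≤s; NonZero)
open import Data.Nat.DivMod using (_%_)
open import Data.Nat.ListAction using (sum)
import Data.Nat.Properties as ℕ
open import Data.Product.Base using (_×_; _,_; proj₁)
open import Function.Base using (_∘_)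
open import Function.Bundles using (_⇔_; mk⇔)
open import Relation.Binary.PropositionalEquality
  using (_≡_; _≢_; refl; sym; trans; cong; subst)
open import Relation.Nullary.Decidable using (_×-dec_; ¬?)
open import Relation.Unary using (Decidable)

open import Data.List.Membership.DecPropositional ℕ._≟_ using (_∈?_)

------------------------------------------------------------------------
-- Integer partitions

record IsPartition (n : ℕ) (xs : List ℕ) : Set where
  constructor isPartition
  field
    decreasing : AllPairs _≥_ xs
    positive   : All (1 ≤_) xs
    sums       : sum xs ≡ n

-- The partitions of n with at most l parts, all of them at most k.

boundedPartitions : (l k n : ℕ) → List (List ℕ)
boundedPartitions l       k zero    = [ [] ]
boundedPartitions zero    k (suc n) = []
boundedPartitions (suc l) k (suc n) =
  concatMap (λ i → map (suc i ∷_) (boundedPartitions l (suc i) (n ∸ i)))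
            (upTo (k ⊓ suc n))

partitions : ℕ → List (List ℕ)
partitions n = boundedPartitions n n n

private
  sound : ∀ l k n {xs} → xs ∈ boundedPartitions l k n →
          IsPartition n xs × All (_≤ k) xs
  sound l       k zero    (here refl) = isPartition [] [] refl , []
  sound (suc l) k (suc n) xs∈
    with i , i∈ , xs∈i ← find (∈-concatMap⁻ _ {xs = upTo (k ⊓ suc n)} xs∈)
    with ys , ys∈ , refl ← ∈-map⁻ (suc i ∷_) xs∈i
    with isPartition dec pos eq , ys≤ ← sound l (suc i) (n ∸ i) ys∈
    = isPartition (ys≤ ∷ dec) (s≤s z≤n ∷ pos)
        (cong suc (trans (cong (i ℕ.+_) eq) (ℕ.m+[n∸m]≡n (ℕ.s≤s⁻¹ i<1+n))))
    , i<k ∷ All.map (λ y≤ → ℕ.≤-trans y≤ i<k) ys≤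
    where
    i<k   = ℕ.≤-trans (∈-upTo⁻ i∈) (ℕ.m⊓n≤m k (suc n))
    i<1+n = ℕ.≤-trans (∈-upTo⁻ i∈) (ℕ.m⊓n≤n k (suc n))

  complete : ∀ l k n {xs} → IsPartition n xs → length xs ≤ l → All (_≤ k) xs →
             xs ∈ boundedPartitions l k n
  complete l       k zero    {[]}         _                     _       _ = here refl
  complete l       k zero    {zero ∷ _}   (isPartition _ (() ∷ _) _) _  _
  complete l       k (suc n) {[]}         (isPartition _ _ ())  _       _
  complete l       k (suc n) {zero ∷ _}   (isPartition _ (() ∷ _) _) _  _
  complete (suc l) k _ {suc i ∷ ys} (isPartition (ys≤ ∷ dec) (_ ∷ pos) refl) (s≤s len) (i<k ∷ _) =
    ∈-concatMap⁺ _ (lose (∈-upTo⁺ (ℕ.⊓-glb i<k (s≤s (ℕ.m≤m+n i (sum ys)))))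
      (∈-map⁺ (suc i ∷_)
        (complete l (suc i) _ (isPartition dec pos (sym (ℕ.m+n∸m≡n i (sum ys)))) len ys≤)))

  length≤sum : ∀ {xs} → All (1 ≤_) xs → length xs ≤ sum xs
  length≤sum []          = z≤n
  length≤sum (1≤x ∷ pos) = ℕ.+-mono-≤ 1≤x (length≤sum pos)

  parts≤sum : ∀ xs → All (_≤ sum xs) xs
  parts≤sum []       = []
  parts≤sum (x ∷ xs) =
    ℕ.m≤m+n x (sum xs) ∷ All.map (λ y≤ → ℕ.≤-trans y≤ (ℕ.m≤n+m (sum xs) x)) (parts≤sum xs)

  distinct : ∀ l k n → Unique (boundedPartitions l k n)
  distinct l       k zero    = [] ∷ []
  distinct zero    k (suc n) = []
  distinct (suc l) k (suc n) = Unique.concat⁺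
    (All.map⁺ (All.universal (λ i → Unique.map⁺ ∷-injectiveʳ (distinct l (suc i) (n ∸ i))) _))
    (AllPairs.map⁺ (AllPairs.map disjoint (Unique.upTo⁺ (k ⊓ suc n))))
    where
    disjoint : ∀ {i j} → i ≢ j →
               Disjoint (map (suc i ∷_) (boundedPartitions l (suc i) (n ∸ i)))
                        (map (suc j ∷_) (boundedPartitions l (suc j) (n ∸ j)))
    disjoint i≢j (xs∈i , xs∈j)
      with _ , _ , refl ← ∈-map⁻ _ xs∈i
      with _ , _ , refl ← ∈-map⁻ _ xs∈j = i≢j refl

∈-partitions : ∀ {n xs} → xs ∈ partitions n ⇔ IsPartition n xs
∈-partitions {n} {xs} = mk⇔ (proj₁ ∘ sound n n n) to-list
  where
  to-list : IsPartition n xs → xs ∈ partitions n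
  to-list p@(isPartition _ pos refl) = complete n n n p (length≤sum pos) (parts≤sum xs)

partitions-unique : ∀ n → Unique (partitions n)
partitions-unique n = distinct n n n

------------------------------------------------------------------------
-- Partition statistics and the two counting functions

#parts≡_mod_ : (r k : ℕ) .{{_ : NonZero k}} → List ℕ → ℕ
(#parts≡ r mod k) xs = length (filter (λ x → x % k ℕ.≟ r) xs)

NoConsecutive : List ℕ → Set
NoConsecutive xs = All (λ x → suc x ∉ xs) xs

noConsecutive? : Decidable NoConsecutive
noConsecutive? xs = All.all? (λ x → ¬? (suc x ∈? xs)) xs

IsB₁ : (m₁ m₂ : ℕ) → List ℕ → Set
IsB₁ m₁ m₂ xs = All (λ x → x % 6 ∈ 0 ∷ 2 ∷ 3 ∷ 4 ∷ []) xs
              × (#parts≡ 2 mod 6) xs ≡ m₁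
              × (#parts≡ 4 mod 6) xs ≡ m₂

isB₁? : ∀ m₁ m₂ → Decidable (IsB₁ m₁ m₂)
isB₁? m₁ m₂ xs = All.all? (λ x → x % 6 ∈? _) xs
           ×-dec (#parts≡ 2 mod 6) xs ℕ.≟ m₁
           ×-dec (#parts≡ 4 mod 6) xs ℕ.≟ m₂

IsB₂ : (m₁ m₂ : ℕ) → List ℕ → Set
IsB₂ m₁ m₂ xs = NoConsecutive xs
              × All (2 ≤_) xs
              × (#parts≡ 1 mod 3) xs ≡ m₂
              × (#parts≡ 2 mod 3) xs ≡ m₁

isB₂? : ∀ m₁ m₂ → Decidable (IsB₂ m₁ m₂)
isB₂? m₁ m₂ xs = noConsecutive? xs
           ×-dec All.all? (2 ℕ.≤?_) xs
           ×-dec (#parts≡ 1 mod 3) xs ℕ.≟ m₂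
           ×-dec (#parts≡ 2 mod 3) xs ℕ.≟ m₁

B₁ : (m₁ m₂ n : ℕ) → ℕ
B₁ m₁ m₂ n = length (filter (isB₁? m₁ m₂) (partitions n))

B₂ : (m₁ m₂ n : ℕ) → ℕ
B₂ m₁ m₂ n = length (filter (isB₂? m₁ m₂) (partitions n))

InΛ : List ℕ → Set
InΛ xs = 1 ∉ xs × NoConsecutive xs

inΛ? : Decidable InΛ
inΛ? xs = ¬? (1 ∈? xs) ×-dec noConsecutive? xs

------------------------------------------------------------------------
-- Formal power series, given by their coefficient sequences

module _ {c ℓ} (R : RawRing c ℓ) where
  private module R = RawRing R

  constant : R.Carrier → ℕ → R.Carrier
  constant r zero    = r
  constant r (suc _) = R.0#

  powerSeries : RawRing c ℓ
  powerSeries = record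
    { Carrier = ℕ → R.Carrier
    ; _≈_     = λ f g → ∀ n → f n R.≈ g n
    ; _+_     = λ f g n → f n R.+ g n
    ; _*_     = λ f g n → RawMonoidDefs.sum R.+-rawMonoid {suc n}
                            (λ i → f (toℕ i) R.* g (n ∸ toℕ i))
    ; -_      = λ f n → R.- f n
    ; 0#      = λ _ → R.0#
    ; 1#      = constant R.1#
    }

  X : RawRing.Carrier powerSeries
  X 1 = R.1#
  X _ = R.0#

  private
    module S where
      open RawRing powerSeries public
      open RawSemiringDefs rawSemiring public using (_^_; product)

  pochhammer : (a b : S.Carrier) → ℕ → S.Carrier
  pochhammer a b n = S.product {n} λ j → S.1# S.+ S.- (a S.* b S.^ toℕ j)

  -- The infinite product is the limit of the finite ones.  When b has zero
  -- constant term (as q³ and q⁶ do), the factors 1 - a bʲ with j > n are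
  -- 1 modulo Xⁿ⁺¹, so the coefficient of Xⁿ is already attained by the
  -- product over j ≤ n.
  pochhammer∞ : (a b : S.Carrier) → S.Carrier
  pochhammer∞ a b n = pochhammer a b (suc n) n

------------------------------------------------------------------------
-- The ring ℤ[[A]][[C]][[q]]

ℤ⟦A⟧ ℤ⟦A,C⟧ ℤ⟦A,C,q⟧ : RawRing _ _
ℤ⟦A⟧     = powerSeries +-*-rawRing
ℤ⟦A,C⟧   = powerSeries ℤ⟦A⟧
ℤ⟦A,C,q⟧ = powerSeries ℤ⟦A,C⟧

module Coeff where
  open RawRing ℤ⟦A,C⟧ public
  open RawSemiringDefs rawSemiring public using (_^_)

  A C : Carrier
  A = constant ℤ⟦A⟧ (X +-*-rawRing)
  C = X ℤ⟦A⟧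

open RawRing ℤ⟦A,C,q⟧ public using (Carrier; _≈_; _*_; 1#)
open RawSemiringDefs (RawRing.rawSemiring ℤ⟦A,C,q⟧) public using (_^_)

A C q : Carrier
A = constant ℤ⟦A,C⟧ Coeff.A
C = constant ℤ⟦A,C⟧ Coeff.C
q = X ℤ⟦A,C⟧

infix 30 ⟨_⨾_⟩∞

⟨_⨾_⟩∞ : Carrier → Carrier → Carrier
⟨ a ⨾ b ⟩∞ = pochhammer∞ ℤ⟦A,C⟧ a b

weight : List ℕ → Coeff.Carrier
weight xs = Coeff.A Coeff.^ (#parts≡ 2 mod 3) xs Coeff.* Coeff.C Coeff.^ (#parts≡ 1 mod 3) xs

-- The sum over λ ∈ Λ of weight(λ) q^|λ|: the coefficient of qⁿ collects the
-- partitions λ ∈ Λ with |λ| = n.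
Λ-series : Carrier
Λ-series n = foldr Coeff._+_ Coeff.0# (map weight (filter inΛ? (partitions n)))

{-# OPTIONS --safe #-}

-- Let λ₁ ≥ λ₂ ≥ … be the parts of λ, padded by zeros.  λ lies in Λ iff no gap λⱼ - λⱼ₊₁ equals 1,
-- and a number other than 1 is uniquely 2a + 3b with b ∈ {0, 1}.  Hence λ = 2μ + 3ν, where μ is an
-- arbitrary partition and ν has successive gaps 0 or 1, that is, ν is conjugate to a partition
-- into distinct parts.  Modulo 3 the parts of λ are those of 2μ, so the weight of λ is that of 2μ,
-- and the generating function of Λ is that of the partitions into even parts times ∏ (1 + q³ⁱ).
-- The even partitions contribute 1 / ((q⁶;q⁶)∞ (Aq²;q⁶)∞ (Cq⁴;q⁶)∞), and
-- (1 + q³ⁱ)(1 - q³ⁱ) = 1 - q⁶ⁱ turns the first factor into 1 / (q³;q³)∞.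
-- The partitions counted by B₁ have the same generating function; comparing coefficients of
-- AᵐCⁿ gives B₁ = B₂.

module Submission where

open import Algebra.Bundles using (CommutativeMonoid; CommutativeRing)
import Algebra.Definitions.RawMonoid as RawMonoidDefs
open import Data.Empty using (⊥; ⊥-elim)
open import Data.Fin.Base using (toℕ)
import Data.Integer.Base as ℤ
import Data.Integer.Properties as ℤ
open import Data.List.Base using (List; []; _∷_; [_]; _++_; concatMap; filter; foldr; length; map; upTo)
open import Data.List.Membership.Propositional using (_∈_; _∉_)
open import Data.List.Membership.Propositional.Properties
  using (∈-filter⁺; ∈-filter⁻; ∈-map⁺; ∈-map⁻; ∈-++⁺ˡ; ∈-++⁺ʳ; ∈-++⁻)
open import Data.List.Membership.Propositional.Properties.WithK using (unique∧set⇒bag)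
open import Data.List.Properties
  using (concatMap-cong; concatMap-++; ++-identityʳ; upTo-∷ʳ; map-∘; map-id-local; filter-accept; filter-reject)
open import Data.List.Relation.Binary.BagAndSetEquality using (∼bag⇒↭)
open import Data.List.Relation.Binary.Permutation.Propositional using (_↭_; prep; swap)
open import Data.List.Relation.Unary.All as All using (All; []; _∷_)
open import Data.List.Relation.Unary.All.Properties using (¬All⇒Any¬)
open import Data.List.Relation.Unary.AllPairs using (AllPairs; []; _∷_)
open import Data.List.Relation.Unary.Any as Any using (Any; here; there)
open import Data.List.Relation.Unary.Unique.Propositional using (Unique)
import Data.List.Relation.Unary.Unique.Propositional.Properties as Unique
open import Data.Nat.Base as ℕ using (ℕ; zero; suc; _∸_; _⊓_; _≤_; _<_; _≥_; z≤n; s≤s; NonZero)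
open import Data.Nat.DivMod using (_%_; m%n<n; [m+kn]%n≡m%n)
open import Data.Nat.ListAction using (sum)
import Data.Nat.Properties as ℕ
open import Data.Product.Base using (_×_; _,_; proj₁; proj₂; ∃-syntax)
open import Data.Sum.Base using (_⊎_; inj₁; inj₂)
open import Function.Base using (_∘_; id)
open import Function.Bundles using (_⇔_; mk⇔; Equivalence)
open import Level using (Level)
open import Relation.Binary.PropositionalEquality as ≡ using (_≡_; _≢_; cong; cong₂; subst)
open import Relation.Nullary.Decidable using (yes; no; ¬?; _×-dec_)
open import Relation.Nullary.Negation using (¬_)
open import Relation.Unary using (Decidable; Pred)

open import Data.List.Membership.DecPropositional ℕ._≟_ using (_∈?_)

open import Defs hiding (_*_; _^_; _≈_; 1#; Carrier; A; C; q)

-- The pair (μ, ν) is never constructed. The passage from i to i + 1 splits on the parity of a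
-- single gap, so the generating function acquires the factor 1 + q³⁽ⁱ⁺¹⁾.
--
-- No limits and no quotients occur. A coefficient of a product depends only on coefficients of the
-- factors up to that degree, so in degree n every infinite product is replaced by a sufficiently
-- long finite one. The series of Λ and that of B₁ are both shown to be inverse to the same
-- denominator, hence are equal.
--
-- Apart from the final coefficient comparison, all this takes place over an arbitrary commutative
-- ring `K` with a weight in `K` for each part size. Giving weight 0 to unwanted sizes lets one
-- product formula for all partitions serve both the even partitions and those of B₁.

private
  variable
    c ℓ a b p : Level

-- The commutative ring of formal power series

module PowerSeries (K : CommutativeRing c ℓ) where
  open CommutativeRing K
  open import Relation.Binary.Reasoning.Setoid setoid
  open import Algebra.Properties.CommutativeSemigroup +-commutativeSemigroup using (interchange; x∙yz≈y∙xz)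

  Series : Set c
  Series = ℕ → Carrier

  infix 4 _≋_
  infixl 7 _⊛_
  infixl 6 _⊕_

  _≋_ : Series → Series → Set ℓ
  f ≋ g = ∀ n → f n ≈ g n

  -- These unfold to the operations of `powerSeries`. By definition `(f ⊛ g) (suc n)` is
  -- `f 0 * g (suc n) + (tail f ⊛ g) n`, which drives the inductions on the degree below.
  _⊕_ _⊛_ : Series → Series → Series
  (f ⊕ g) n = f n + g n
  (f ⊛ g) n = RawMonoidDefs.sum +-rawMonoid {suc n} λ i → f (toℕ i) * g (n ∸ toℕ i)

  tail : Series → Series
  tail f n = f (suc n)

  _·_ : Carrier → Series → Series
  (a · f) n = a * f n

  ⊛-zero : ∀ f g → (f ⊛ g) 0 ≈ f 0 * g 0
  ⊛-zero f g = +-identityʳ _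

  -- The means of exchanging a series for a truncation of it: coefficient `n` of a product reads no
  -- coefficient beyond `n`.
  ⊛-cong≤ : ∀ {f f′ g g′} n → (∀ {i} → i ≤ n → f i ≈ f′ i) → (∀ {i} → i ≤ n → g i ≈ g′ i) →
            (f ⊛ g) n ≈ (f′ ⊛ g′) n
  ⊛-cong≤ zero    f≈ g≈ = +-congʳ (*-cong (f≈ z≤n) (g≈ z≤n))
  ⊛-cong≤ (suc n) f≈ g≈ = +-cong (*-cong (f≈ z≤n) (g≈ ℕ.≤-refl))
    (⊛-cong≤ n (λ i≤n → f≈ (s≤s i≤n)) (λ i≤n → g≈ (ℕ.m≤n⇒m≤1+n i≤n)))

  ⊛-cong : ∀ {f f′ g g′} → f ≋ f′ → g ≋ g′ → f ⊛ g ≋ f′ ⊛ g′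
  ⊛-cong f≋ g≋ n = ⊛-cong≤ n (λ {i} _ → f≋ i) (λ {i} _ → g≋ i)

  ⊛-distribʳ : ∀ h f g → (f ⊕ g) ⊛ h ≋ f ⊛ h ⊕ g ⊛ h
  ⊛-distribʳ h f g zero    = trans (⊛-zero (f ⊕ g) h)
    (trans (distribʳ _ _ _) (sym (+-cong (⊛-zero f h) (⊛-zero g h))))
  ⊛-distribʳ h f g (suc n) =
    trans (+-cong (distribʳ _ _ _) (⊛-distribʳ h (tail f) (tail g) n)) (interchange _ _ _ _)

  ·-⊛ : ∀ a f g → (a · f) ⊛ g ≋ a · (f ⊛ g)
  ·-⊛ a f g zero    = trans (⊛-zero (a · f) g) (trans (*-assoc _ _ _) (*-congˡ (sym (⊛-zero f g))))
  ·-⊛ a f g (suc n) = trans (+-cong (*-assoc _ _ _) (·-⊛ a (tail f) g n)) (sym (distribˡ _ _ _))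

  -- The definition splits off the term containing `f 0`; commutativity also needs the term
  -- containing `g 0` split off.
  ⊛-sucʳ : ∀ f g n → (f ⊛ g) (suc n) ≈ f (suc n) * g 0 + (f ⊛ tail g) n
  ⊛-sucʳ f g zero    = begin
    f 0 * g 1 + (f 1 * g 0 + 0#)  ≈⟨ x∙yz≈y∙xz _ _ _ ⟩
    f 1 * g 0 + (f 0 * g 1 + 0#)  ∎
  ⊛-sucʳ f g (suc n) = begin
    f 0 * g (2 ℕ.+ n) + (tail f ⊛ g) (suc n)                      ≈⟨ +-congˡ (⊛-sucʳ (tail f) g n) ⟩
    f 0 * g (2 ℕ.+ n) + (f (2 ℕ.+ n) * g 0 + (tail f ⊛ tail g) n)  ≈⟨ x∙yz≈y∙xz _ _ _ ⟩
    f (2 ℕ.+ n) * g 0 + (f ⊛ tail g) (suc n)                      ∎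

  ⊛-comm : ∀ f g → f ⊛ g ≋ g ⊛ f
  ⊛-comm f g zero    = +-congʳ (*-comm _ _)
  ⊛-comm f g (suc n) = begin
    f 0 * g (suc n) + (tail f ⊛ g) n  ≈⟨ +-cong (*-comm _ _) (⊛-comm (tail f) g n) ⟩
    g (suc n) * f 0 + (g ⊛ tail f) n  ≈⟨ ⊛-sucʳ g f n ⟨
    (g ⊛ f) (suc n)                   ∎

  ⊛-assoc : ∀ f g h → (f ⊛ g) ⊛ h ≋ f ⊛ (g ⊛ h)
  ⊛-assoc f g h zero    = begin
    ((f ⊛ g) ⊛ h) 0    ≈⟨ ⊛-zero (f ⊛ g) h ⟩
    (f ⊛ g) 0 * h 0    ≈⟨ *-congʳ (⊛-zero f g) ⟩
    f 0 * g 0 * h 0    ≈⟨ *-assoc _ _ _ ⟩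
    f 0 * (g 0 * h 0)  ≈⟨ *-congˡ (⊛-zero g h) ⟨
    f 0 * (g ⊛ h) 0    ≈⟨ ⊛-zero f (g ⊛ h) ⟨
    (f ⊛ (g ⊛ h)) 0    ∎
  ⊛-assoc f g h (suc n) = begin
    (f ⊛ g) 0 * h (suc n) + ((f 0 · tail g ⊕ tail f ⊛ g) ⊛ h) n
      ≈⟨ +-cong (trans (*-congʳ (⊛-zero f g)) (*-assoc _ _ _))
           (trans (⊛-distribʳ h (f 0 · tail g) (tail f ⊛ g) n)
                  (+-cong (·-⊛ (f 0) (tail g) h n) (⊛-assoc (tail f) g h n))) ⟩
    f 0 * (g 0 * h (suc n)) + (f 0 * (tail g ⊛ h) n + (tail f ⊛ (g ⊛ h)) n)
      ≈⟨ +-assoc _ _ _ ⟨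
    f 0 * (g 0 * h (suc n)) + f 0 * (tail g ⊛ h) n + (tail f ⊛ (g ⊛ h)) n
      ≈⟨ +-congʳ (distribˡ _ _ _) ⟨
    f 0 * (g ⊛ h) (suc n) + (tail f ⊛ (g ⊛ h)) n
      ∎

  0-⊛ : ∀ g → (λ _ → 0#) ⊛ g ≋ (λ _ → 0#)
  0-⊛ g zero    = trans (+-identityʳ _) (zeroˡ _)
  0-⊛ g (suc n) = trans (+-cong (zeroˡ _) (0-⊛ g n)) (+-identityˡ _)

  constant-⊛ : ∀ a g → constant rawRing a ⊛ g ≋ a · g
  constant-⊛ a g zero    = +-identityʳ _
  constant-⊛ a g (suc n) = trans (+-congˡ (0-⊛ g n)) (+-identityʳ _)

  ⊛-identityˡ : ∀ g → constant rawRing 1# ⊛ g ≋ g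
  ⊛-identityˡ g n = trans (constant-⊛ 1# g n) (*-identityˡ _)

  ⊛-identityʳ : ∀ g → g ⊛ constant rawRing 1# ≋ g
  ⊛-identityʳ g n = trans (⊛-comm g (constant rawRing 1#) n) (⊛-identityˡ g n)

  ⊛-distribˡ : ∀ h f g → h ⊛ (f ⊕ g) ≋ h ⊛ f ⊕ h ⊛ g
  ⊛-distribˡ h f g n = trans (⊛-comm h (f ⊕ g) n)
    (trans (⊛-distribʳ h f g n) (+-cong (⊛-comm f h n) (⊛-comm g h n)))

  powerSeriesRing : CommutativeRing c ℓ
  powerSeriesRing = record
    { Carrier = Series
    ; _≈_ = _≋_
    ; _+_ = _⊕_
    ; _*_ = _⊛_
    ; -_ = λ f n → - f n
    ; 0# = λ _ → 0#
    ; 1# = constant rawRing 1#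
    ; isCommutativeRing = record
      { isRing = record
        { +-isAbelianGroup = record
          { isGroup = record
            { isMonoid = record
              { isSemigroup = record
                { isMagma = record
                  { isEquivalence = record
                    { refl = λ _ → refl
                    ; sym = λ f≋g n → sym (f≋g n)
                    ; trans = λ f≋g g≋h n → trans (f≋g n) (g≋h n)
                    }
                  ; ∙-cong = λ f≋ g≋ n → +-cong (f≋ n) (g≋ n)
                  }
                ; assoc = λ _ _ _ _ → +-assoc _ _ _
                }
              ; identity = (λ _ _ → +-identityˡ _) , (λ _ _ → +-identityʳ _)
              }
            ; inverse = (λ _ _ → -‿inverseˡ _) , (λ _ _ → -‿inverseʳ _)
            ; ⁻¹-cong = λ f≋g n → -‿cong (f≋g n)
            }
          ; comm = λ _ _ _ → +-comm _ _
          }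
        ; *-cong = ⊛-cong
        ; *-assoc = ⊛-assoc
        ; *-identity = ⊛-identityˡ , ⊛-identityʳ
        ; distrib = ⊛-distribˡ , ⊛-distribʳ
        }
      ; *-comm = ⊛-comm
      }
    }

-- Finite products and elementary ring identities

module FiniteProduct (M : CommutativeMonoid c ℓ) where
  open CommutativeMonoid M renaming (_∙_ to _*_; ε to 1#; ∙-cong to *-cong; ∙-congˡ to *-congˡ; ∙-congʳ to *-congʳ)
  open import Algebra.Definitions.RawMonoid rawMonoid using () renaming (sum to product)
  open import Algebra.Properties.CommutativeSemigroup commutativeSemigroup using (interchange)

  -- The last factor is split off, whereas `product` splits off the first: lengthening a truncation
  -- then just multiplies on the right.
  Π : ℕ → (ℕ → Carrier) → Carrier
  Π zero    f = 1#
  Π (suc N) f = Π N f * f N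

  Π-cong : ∀ N {f g : ℕ → Carrier} → (∀ j → f j ≈ g j) → Π N f ≈ Π N g
  Π-cong zero    f≈g = refl
  Π-cong (suc N) f≈g = *-cong (Π-cong N f≈g) (f≈g N)

  Π-* : ∀ N (f g : ℕ → Carrier) → Π N f * Π N g ≈ Π N (λ j → f j * g j)
  Π-* zero    f g = identityˡ _
  Π-* (suc N) f g = trans (interchange _ _ _ _) (*-congʳ (Π-* N f g))

  Π-*₃ : ∀ N (f g h : ℕ → Carrier) → Π N f * Π N g * Π N h ≈ Π N (λ j → f j * g j * h j)
  Π-*₃ N f g h = trans (*-congʳ (Π-* N f g)) (Π-* N (λ j → f j * g j) h)

  Π-split : ∀ N (f : ℕ → Carrier) → f 0 * Π N (f ∘ suc) ≈ Π (suc N) f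
  Π-split zero    f = comm _ _
  Π-split (suc N) f = trans (sym (assoc _ _ _)) (*-congʳ (Π-split N f))

  product≈Π : ∀ N (f : ℕ → Carrier) → product {N} (f ∘ toℕ) ≈ Π N f
  product≈Π zero    f = refl
  product≈Π (suc N) f = trans (*-congˡ (product≈Π N (f ∘ suc))) (Π-split N f)

  Π-group₂ : ∀ N (f : ℕ → Carrier) → Π (N ℕ.* 2) f ≈ Π N (λ i → f (i ℕ.* 2) * f (1 ℕ.+ i ℕ.* 2))
  Π-group₂ zero    f = refl
  Π-group₂ (suc N) f = trans (assoc _ _ _) (*-congʳ (Π-group₂ N f))

  Π-group₆ : ∀ N (f : ℕ → Carrier) → Π (N ℕ.* 6) f ≈ Π N (λ i → let j = i ℕ.* 6 in
             f j * f (1 ℕ.+ j) * f (2 ℕ.+ j) * f (3 ℕ.+ j) * f (4 ℕ.+ j) * f (5 ℕ.+ j))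
  Π-group₆ zero    f = refl
  Π-group₆ (suc N) f = trans
    (solve 7 (λ p a b c d e g → ((((((p :* a) :* b) :* c) :* d) :* e) :* g) ⊜
                                (p :* (((((a :* b) :* c) :* d) :* e) :* g))) refl _ _ _ _ _ _ _)
    (*-congʳ (Π-group₆ N f))
    where open import Algebra.Solver.CommutativeMonoid M using (solve; _⊜_) renaming (_⊕_ to _:*_)

module Rearrangements (M : CommutativeMonoid c ℓ) where
  open CommutativeMonoid M
  open import Algebra.Solver.CommutativeMonoid M using (solve; _⊜_; _⊕_) renaming (id to ε′)

  xd∙pac≈x∙dpac : ∀ x d p a c → (x ∙ d) ∙ ((p ∙ a) ∙ c) ≈ x ∙ (((d ∙ p) ∙ a) ∙ c)
  xd∙pac≈x∙dpac = solve 5 (λ x d p a c → (x ⊕ d) ⊕ ((p ⊕ a) ⊕ c) ⊜ x ⊕ (((d ⊕ p) ⊕ a) ⊕ c)) refl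

  uac≈aεcu : ∀ u a c → (u ∙ a) ∙ c ≈ ((a ∙ ε) ∙ c) ∙ u
  uac≈aεcu = solve 3 (λ u a c → (u ⊕ a) ⊕ c ⊜ ((a ⊕ ε′) ⊕ c) ⊕ u) refl

  stac≈asct : ∀ s t a c → ((s ∙ t) ∙ a) ∙ c ≈ ((a ∙ s) ∙ c) ∙ t
  stac≈asct = solve 4 (λ s t a c → ((s ⊕ t) ⊕ a) ⊕ c ⊜ ((a ⊕ s) ⊕ c) ⊕ t) refl

module CommutativeRingLemmas (R : CommutativeRing c ℓ) where
  open CommutativeRing R
  open import Algebra.Properties.Ring ring
  open import Relation.Binary.Reasoning.Setoid setoid

  x*[1-y] : ∀ x y → x * (1# + - y) ≈ x + - (y * x)
  x*[1-y] x y = begin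
    x * (1# + - y)      ≈⟨ distribˡ x 1# (- y) ⟩
    x * 1# + x * - y    ≈⟨ +-cong (*-identityʳ x) (sym (-‿distribʳ-* x y)) ⟩
    x + - (x * y)       ≈⟨ +-congˡ (-‿cong (*-comm x y)) ⟩
    x + - (y * x)       ∎

  -- Turns a recurrence for a generating function into a product formula without dividing.
  x≈y+z*x⇒x*[1-z]≈y : ∀ {x y z} → x ≈ y + z * x → x * (1# + - z) ≈ y
  x≈y+z*x⇒x*[1-z]≈y {x} {y} {z} x≈ = begin
    x * (1# + - z)             ≈⟨ x*[1-y] x z ⟩
    x + - (z * x)              ≈⟨ +-congʳ x≈ ⟩
    y + z * x + - (z * x)      ≈⟨ +-assoc y _ _ ⟩
    y + (z * x + - (z * x))    ≈⟨ +-congˡ (-‿inverseʳ _) ⟩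
    y + 0#                     ≈⟨ +-identityʳ y ⟩
    y                          ∎

  [1+x]*[1-x] : ∀ x → (1# + x) * (1# + - x) ≈ 1# + - (x * x)
  -- The recurrence used is 1 + x = (1 - x²) + x (1 + x).
  [1+x]*[1-x] x = x≈y+z*x⇒x*[1-z]≈y (begin
    1# + x                                 ≈⟨ +-congˡ (*-identityʳ x) ⟨
    1# + x * 1#                            ≈⟨ +-congʳ (+-identityʳ 1#) ⟨
    1# + 0# + x * 1#                       ≈⟨ +-congʳ (+-congˡ (-‿inverseˡ (x * x))) ⟨
    1# + (- (x * x) + x * x) + x * 1#      ≈⟨ +-congʳ (+-assoc 1# _ _) ⟨
    1# + - (x * x) + x * x + x * 1#        ≈⟨ +-assoc _ _ _ ⟩
    1# + - (x * x) + (x * x + x * 1#)      ≈⟨ +-congˡ (+-comm _ _) ⟩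
    1# + - (x * x) + (x * 1# + x * x)      ≈⟨ +-congˡ (distribˡ x 1# x) ⟨
    1# + - (x * x) + x * (1# + x)          ∎)

  inverse-unique : ∀ {x y} z → x * z ≈ 1# → y * z ≈ 1# → x ≈ y
  inverse-unique {x} {y} z xz≈1 yz≈1 = begin
    x              ≈⟨ *-identityʳ x ⟨
    x * 1#         ≈⟨ *-congˡ yz≈1 ⟨
    x * (y * z)    ≈⟨ *-congˡ (*-comm y z) ⟩
    x * (z * y)    ≈⟨ *-assoc x z y ⟨
    x * z * y      ≈⟨ *-congʳ xz≈1 ⟩
    1# * y         ≈⟨ *-identityˡ y ⟩
    y              ∎

module SeriesRing (K : CommutativeRing c ℓ) where
  open CommutativeRing (PowerSeries.powerSeriesRing K) public
  open import Algebra.Properties.Semiring.Exp semiring public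
  open CommutativeRingLemmas (PowerSeries.powerSeriesRing K) public
  open FiniteProduct *-commutativeMonoid public
  open Rearrangements *-commutativeMonoid public

-- Monomials, factors 1 - a qᵐ and truncated infinite products

module Truncation (K : CommutativeRing c ℓ) where
  open CommutativeRing K
  open PowerSeries K using (Series; powerSeriesRing; ⊛-zero; ⊛-cong≤; constant-⊛)
  private module S = SeriesRing K
  open import Algebra.Properties.Ring ring using (-0#≈0#)
  open import Algebra.Properties.Semiring.Exp semiring using (_^_)
  module ≋-Reasoning where
    open import Relation.Binary.Reasoning.Setoid S.setoid public
  open ≋-Reasoning

  -- The series a qᵐ, defined by shifting so that its coefficients compute; `constant*X^≈monomial`
  -- relates it to powers of `X`.
  monomial : Carrier → ℕ → Series
  monomial a zero            = constant rawRing a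
  monomial a (suc m) zero    = 0#
  monomial a (suc m) (suc n) = monomial a m n

  monomial-cong : ∀ {a b} → a ≈ b → ∀ m → monomial a m S.≈ monomial b m
  monomial-cong a≈b zero    zero    = a≈b
  monomial-cong a≈b zero    (suc n) = refl
  monomial-cong a≈b (suc m) zero    = refl
  monomial-cong a≈b (suc m) (suc n) = monomial-cong a≈b m n

  monomial-*-< : ∀ a f {m n} → n < m → (monomial a m S.* f) n ≈ 0#
  monomial-*-< a f {suc m} {zero}  _         = trans (⊛-zero (monomial a (suc m)) f) (zeroˡ _)
  monomial-*-< a f {suc m} {suc n} (s≤s n<m) =
    trans (+-cong (zeroˡ _) (monomial-*-< a f n<m)) (+-identityˡ _)

  monomial-*-+ : ∀ a f m n → (monomial a m S.* f) (m ℕ.+ n) ≈ a * f n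
  monomial-*-+ a f zero    n = constant-⊛ a f n
  monomial-*-+ a f (suc m) n = trans (+-cong (zeroˡ _) (monomial-*-+ a f m n)) (+-identityˡ _)

  monomial-* : ∀ a b m n → monomial a m S.* monomial b n S.≈ monomial (a * b) (m ℕ.+ n)
  monomial-* a b zero n k = trans (constant-⊛ a (monomial b n) k) (scale n k)
    where
    scale : ∀ n k → a * monomial b n k ≈ monomial (a * b) n k
    scale zero    zero    = refl
    scale zero    (suc k) = zeroʳ _
    scale (suc n) zero    = zeroʳ _
    scale (suc n) (suc k) = scale n k
  monomial-* a b (suc m) n zero    =
    trans (⊛-zero (monomial a (suc m)) (monomial b n)) (zeroˡ _)
  monomial-* a b (suc m) n (suc k) =
    trans (+-cong (zeroˡ _) (monomial-* a b m n k)) (+-identityˡ _)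

  monomial-1-* : ∀ a m n → monomial a m S.* monomial 1# n S.≈ monomial a (m ℕ.+ n)
  monomial-1-* a m n = S.trans (monomial-* a 1# m n) (monomial-cong (*-identityʳ a) (m ℕ.+ n))

  monomial-diagonal : ∀ a m → monomial a m m ≈ a
  monomial-diagonal a zero    = refl
  monomial-diagonal a (suc m) = monomial-diagonal a m

  monomial-off-diagonal : ∀ a {m n} → m ≢ n → monomial a m n ≈ 0#
  monomial-off-diagonal a {zero}  {zero}  m≢n = ⊥-elim (m≢n ≡.refl)
  monomial-off-diagonal a {zero}  {suc n} m≢n = refl
  monomial-off-diagonal a {suc m} {zero}  m≢n = refl
  monomial-off-diagonal a {suc m} {suc n} m≢n = monomial-off-diagonal a (m≢n ∘ ≡.cong suc)

  constant-^ : ∀ a n → constant rawRing a S.^ n S.≈ constant rawRing (a ^ n)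
  constant-^ a zero    = S.refl
  constant-^ a (suc n) = S.trans (S.*-congˡ {monomial a 0} (constant-^ a n)) (monomial-* a (a ^ n) 0 0)

  X≈monomial : X rawRing S.≈ monomial 1# 1
  X≈monomial 0             = refl
  X≈monomial 1             = refl
  X≈monomial (suc (suc n)) = refl

  monomial-^ : ∀ m n → monomial 1# m S.^ n S.≈ monomial 1# (n ℕ.* m)
  monomial-^ m zero    = S.refl
  monomial-^ m (suc n) = begin
    monomial 1# m S.* monomial 1# m S.^ n      ≈⟨ S.*-congˡ {monomial 1# m} (monomial-^ m n) ⟩
    monomial 1# m S.* monomial 1# (n ℕ.* m)    ≈⟨ monomial-1-* 1# m (n ℕ.* m) ⟩
    monomial 1# (m ℕ.+ n ℕ.* m)                ∎

  X^≈monomial : ∀ n → X rawRing S.^ n S.≈ monomial 1# n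
  X^≈monomial n = begin
    X rawRing S.^ n         ≈⟨ S.^-congˡ n X≈monomial ⟩
    monomial 1# 1 S.^ n     ≈⟨ monomial-^ 1 n ⟩
    monomial 1# (n ℕ.* 1)   ≡⟨ ≡.cong (monomial 1#) (ℕ.*-identityʳ n) ⟩
    monomial 1# n           ∎

  constant*X^≈monomial : ∀ a m → constant rawRing a S.* X rawRing S.^ m S.≈ monomial a m
  constant*X^≈monomial a m =
    S.trans (S.*-congˡ {monomial a 0} (X^≈monomial m)) (monomial-1-* a 0 m)

  factor : Carrier → ℕ → Series
  factor a m = S.1# S.+ S.- monomial a m

  factor-cong : ∀ {a b} → a ≈ b → ∀ m → factor a m S.≈ factor b m
  factor-cong a≈b m = S.+-congˡ {S.1#} (S.-‿cong (monomial-cong a≈b m))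

  *-factor-< : ∀ f a {m n} → n < m → (f S.* factor a m) n ≈ f n
  *-factor-< f a {m} {n} n<m = trans (S.x*[1-y] f (monomial a m) n)
    (trans (+-congˡ (trans (-‿cong (monomial-*-< a f n<m)) -0#≈0#)) (+-identityʳ _))

  1+monomial : ℕ → Series
  1+monomial m = S.1# S.+ monomial 1# m

  1+monomial-*-factor : ∀ m → 1+monomial m S.* factor 1# m S.≈ factor 1# (m ℕ.+ m)
  1+monomial-*-factor m = S.trans (S.[1+x]*[1-x] (monomial 1# m))
    (S.+-congˡ {S.1#} (S.-‿cong (monomial-1-* 1# m m)))

  pochhammer≈Π : ∀ {f g} a d e → f S.≈ monomial a d → g S.≈ monomial 1# e →
                 ∀ N → pochhammer rawRing f g N S.≈ S.Π N (λ j → factor a (d ℕ.+ j ℕ.* e))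
  pochhammer≈Π {f} {g} a d e f≈ g≈ N = begin
    pochhammer rawRing f g N
      ≈⟨ S.product≈Π N (λ j → S.1# S.+ S.- (f S.* g S.^ j)) ⟩
    S.Π N (λ j → S.1# S.+ S.- (f S.* g S.^ j))
      ≈⟨ S.Π-cong N (λ j → S.+-congˡ {S.1#} (S.-‿cong (S.trans
           (S.*-cong f≈ (S.trans (S.^-congˡ j g≈) (monomial-^ e j))) (monomial-1-* a d (j ℕ.* e))))) ⟩
    S.Π N (λ j → factor a (d ℕ.+ j ℕ.* e))
      ∎

  -- A factor with index above `n` has exponent above `n`, so it leaves coefficient `n` unchanged.
  Π-stable : ∀ (a : ℕ → Carrier) (s : ℕ → ℕ) → (∀ j → j < s j) → ∀ n k →
             S.Π (k ℕ.+ suc n) (λ j → factor (a j) (s j)) n ≈ S.Π (suc n) (λ j → factor (a j) (s j)) n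
  Π-stable a s j<s n zero    = refl
  Π-stable a s j<s n (suc k) = trans
    (*-factor-< (S.Π (k ℕ.+ suc n) (λ j → factor (a j) (s j))) _
      (ℕ.≤-<-trans (ℕ.≤-trans (ℕ.n≤1+n n) (ℕ.m≤n+m (suc n) k)) (j<s _)))
    (Π-stable a s j<s n k)

  -- Below degree N, p is the truncation to N factors of (a qᵈ ; qᵉ)∞.
  record TruncatesTo (p : Series) (a : Carrier) (d e : ℕ) : Set ℓ where
    constructor truncatesTo
    field
      truncation : ∀ {N n} → n < N → p n ≈ S.Π N (λ j → factor a (d ℕ.+ j ℕ.* e)) n
  open TruncatesTo public

  pochhammer∞-truncates : ∀ {f g} a d e → f S.≈ monomial a (suc d) → g S.≈ monomial 1# (suc e) →
                          TruncatesTo (pochhammer∞ rawRing f g) a (suc d) (suc e)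
  pochhammer∞-truncates a d e f≈ g≈ = truncatesTo λ {N} {n} n<N → trans
    (pochhammer≈Π a (suc d) (suc e) f≈ g≈ (suc n) n)
    (trans (sym (Π-stable (λ _ → a) (λ j → suc d ℕ.+ j ℕ.* suc e)
                  -- Both the initial exponent and the step are at least 1, so the exponent of
                  -- factor `j` exceeds `j`.
                  (λ j → s≤s (ℕ.≤-trans (ℕ.m≤m*n j (suc e)) (ℕ.m≤n+m _ d))) n (N ∸ suc n)))
           (reflexive (≡.cong (λ M → S.Π M (λ j → factor a (suc d ℕ.+ j ℕ.* suc e)) n) (ℕ.m∸n+n≡m n<N))))

-- Generating functions of partitions weighted by their parts

-- A partition of `n` has at most `n` parts, so a length bound of `n` or more is vacuous.
boundedPartitions-fuel : ∀ {l l′ n} k → n ≤ l → n ≤ l′ → boundedPartitions l k n ≡ boundedPartitions l′ k n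
boundedPartitions-fuel {n = zero}  k _         _          = ≡.refl
boundedPartitions-fuel {n = suc n} k (s≤s n≤l) (s≤s n≤l′) = concatMap-cong
  (λ i → cong (map (suc i ∷_)) (boundedPartitions-fuel (suc i)
    (ℕ.≤-trans (ℕ.m∸n≤m n i) n≤l) (ℕ.≤-trans (ℕ.m∸n≤m n i) n≤l′))) (upTo (k ⊓ suc n))

boundedPartitions-bound : ∀ {k k′ n} l → n ≤ k → n ≤ k′ → boundedPartitions l k n ≡ boundedPartitions l k′ n
boundedPartitions-bound {n = zero}  l       _   _    = ≡.refl
boundedPartitions-bound {n = suc n} zero    _   _    = ≡.refl
boundedPartitions-bound {k} {k′} {suc n} (suc l) n≤k n≤k′ =
  cong (λ m → concatMap (λ i → map (suc i ∷_) (boundedPartitions l (suc i) (n ∸ i))) (upTo m))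
    (≡.trans (ℕ.m≥n⇒m⊓n≡n n≤k) (≡.sym (ℕ.m≥n⇒m⊓n≡n n≤k′)))

-- The last index `k` of the enumeration contributes exactly the partitions with largest part
-- `suc k`; the smaller indices give the first summand.
boundedPartitions-split : ∀ l k n → suc k ℕ.+ n ≤ l → boundedPartitions l (suc k) (suc k ℕ.+ n) ≡
  boundedPartitions l k (suc k ℕ.+ n) ++ map (suc k ∷_) (boundedPartitions l (suc k) n)
boundedPartitions-split (suc l) k n (s≤s k+n≤l) = begin
  concatMap f (upTo (suc k ⊓ suc (k ℕ.+ n)))   ≡⟨ cong (concatMap f ∘ upTo) (ℕ.m≤n⇒m⊓n≡m (s≤s (ℕ.m≤m+n k n))) ⟩
  concatMap f (upTo (suc k))                   ≡⟨ cong (concatMap f) (upTo-∷ʳ k) ⟨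
  concatMap f (upTo k ++ [ k ])                ≡⟨ concatMap-++ f (upTo k) [ k ] ⟩
  concatMap f (upTo k) ++ (f k ++ [])          ≡⟨ cong₂ (λ m xs → concatMap f (upTo m) ++ xs)
                                                    (≡.sym (ℕ.m≤n⇒m⊓n≡m (ℕ.m≤n⇒m≤1+n (ℕ.m≤m+n k n)))) f[k] ⟩
  concatMap f (upTo (k ⊓ suc (k ℕ.+ n))) ++ map (suc k ∷_) (boundedPartitions (suc l) (suc k) n)
                                               ∎
  where
  open ≡.≡-Reasoning
  f : ℕ → List (List ℕ)
  f i = map (suc i ∷_) (boundedPartitions l (suc i) (k ℕ.+ n ∸ i))
  n≤l = ℕ.≤-trans (ℕ.m≤n+m n k) k+n≤l
  f[k] : f k ++ [] ≡ map (suc k ∷_) (boundedPartitions (suc l) (suc k) n)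
  f[k] = ≡.trans (++-identityʳ (f k)) (cong (map (suc k ∷_)) (≡.trans
    (cong (boundedPartitions l (suc k)) (ℕ.m+n∸m≡n k n))
    (boundedPartitions-fuel (suc k) n≤l (ℕ.m≤n⇒m≤1+n n≤l))))

module Summation (K : CommutativeRing c ℓ) where
  open CommutativeRing K

  ∑ : {A : Set a} → (A → Carrier) → List A → Carrier
  ∑ f xs = foldr _+_ 0# (map f xs)

  ∑-cong : {A : Set a} {f g : A → Carrier} {xs : List A} → All (λ x → f x ≈ g x) xs → ∑ f xs ≈ ∑ g xs
  ∑-cong []       = refl
  ∑-cong (e ∷ es) = +-cong e (∑-cong es)

  ∑-++ : {A : Set a} (f : A → Carrier) (xs ys : List A) → ∑ f (xs ++ ys) ≈ ∑ f xs + ∑ f ys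
  ∑-++ f []       ys = sym (+-identityˡ _)
  ∑-++ f (x ∷ xs) ys = trans (+-congˡ (∑-++ f xs ys)) (sym (+-assoc _ _ _))

  ∑-map : {A : Set a} {B : Set b} (f : B → Carrier) (g : A → B) (xs : List A) → ∑ f (map g xs) ≈ ∑ (f ∘ g) xs
  ∑-map f g []       = refl
  ∑-map f g (x ∷ xs) = +-congˡ (∑-map f g xs)

  ∑-*ˡ : {A : Set a} (y : Carrier) (f : A → Carrier) (xs : List A) → ∑ (λ x → y * f x) xs ≈ y * ∑ f xs
  ∑-*ˡ y f []       = sym (zeroʳ _)
  ∑-*ˡ y f (x ∷ xs) = trans (+-congˡ (∑-*ˡ y f xs)) (sym (distribˡ _ _ _))

  ∑-↭ : {A : Set a} (f : A → Carrier) {xs ys : List A} → xs ↭ ys → ∑ f xs ≈ ∑ f ys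
  ∑-↭ f _↭_.refl          = refl
  ∑-↭ f (prep x xs↭ys)    = +-congˡ (∑-↭ f xs↭ys)
  ∑-↭ f (swap x y xs↭ys)  = trans (+-congˡ (+-congˡ (∑-↭ f xs↭ys))) (x∙yz≈y∙xz _ _ _)
    where open import Algebra.Properties.CommutativeSemigroup +-commutativeSemigroup using (x∙yz≈y∙xz)
  ∑-↭ f (_↭_.trans p q)   = trans (∑-↭ f p) (∑-↭ f q)

  ∑-filter : {A : Set a} {P : Pred A p} (P? : Decidable P) {f g : A → Carrier} (xs : List A) →
             (∀ x → P x → f x ≈ g x) → (∀ x → ¬ P x → g x ≈ 0#) → ∑ f (filter P? xs) ≈ ∑ g xs
  ∑-filter P? []       f≈g g≈0 = refl
  ∑-filter P? (x ∷ xs) f≈g g≈0 with P? x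
  ... | yes px = +-cong (f≈g x px) (∑-filter P? xs f≈g g≈0)
  ... | no ¬px = trans (∑-filter P? xs f≈g g≈0) (trans (sym (+-identityˡ _)) (+-congʳ (sym (g≈0 x ¬px))))

module Weighted (K : CommutativeRing c ℓ) (w : ℕ → CommutativeRing.Carrier K) where
  open CommutativeRing K
  open Summation K
  open Truncation K
  private module S = SeriesRing K

  wt : List ℕ → Carrier
  wt = foldr (λ x y → w x * y) 1#

  wt-zero : ∀ {xs} → Any (λ x → w x ≈ 0#) xs → wt xs ≈ 0#
  wt-zero (here w≈0)  = trans (*-congʳ w≈0) (zeroˡ _)
  wt-zero (there any) = trans (*-congˡ (wt-zero any)) (zeroʳ _)

  bounded : ℕ → ℕ → Carrier
  bounded k n = ∑ wt (boundedPartitions n k n)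

  series : ℕ → Carrier
  series n = ∑ wt (partitions n)

  bounded-zero : bounded 0 S.≈ S.1#
  bounded-zero zero    = +-identityʳ _
  bounded-zero (suc n) = refl

  -- Either no part equals `suc k`, or one such part can be removed, which leaves the bound `suc k`
  -- in force.
  bounded-suc : ∀ k → bounded (suc k) S.≈ bounded k S.+ monomial (w (suc k)) (suc k) S.* bounded (suc k)
  bounded-suc k n with suc k ℕ.≤? n
  ... | no k≮n = trans (reflexive (cong (∑ wt) (boundedPartitions-bound n (ℕ.m≤n⇒m≤1+n n≤k) n≤k)))
    (trans (sym (+-identityʳ _)) (+-congˡ (sym (monomial-*-< (w (suc k)) (bounded (suc k)) (s≤s n≤k)))))
    where n≤k = ℕ.s≤s⁻¹ (ℕ.≰⇒> k≮n)
  ... | yes k<n with n′ ← n ∸ suc k | ≡.refl ← ℕ.m+[n∸m]≡n k<n = begin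
    bounded (suc k) (suc k ℕ.+ n′)
      ≡⟨ cong (∑ wt) (boundedPartitions-split _ k n′ ℕ.≤-refl) ⟩
    ∑ wt (boundedPartitions N k N ++ map (suc k ∷_) (boundedPartitions N (suc k) n′))
      ≈⟨ ∑-++ wt (boundedPartitions N k N) _ ⟩
    bounded k N + ∑ wt (map (suc k ∷_) (boundedPartitions N (suc k) n′))
      ≈⟨ +-congˡ (∑-map wt (suc k ∷_) (boundedPartitions N (suc k) n′)) ⟩
    bounded k N + ∑ (wt ∘ (suc k ∷_)) (boundedPartitions N (suc k) n′)
      ≈⟨ +-congˡ (∑-*ˡ (w (suc k)) wt (boundedPartitions N (suc k) n′)) ⟩
    bounded k N + w (suc k) * ∑ wt (boundedPartitions N (suc k) n′)
      ≡⟨ cong (λ L → bounded k N + w (suc k) * ∑ wt L)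
           (boundedPartitions-fuel (suc k) (ℕ.m≤n+m n′ (suc k)) ℕ.≤-refl) ⟩
    bounded k N + w (suc k) * bounded (suc k) n′
      ≈⟨ +-congˡ (monomial-*-+ (w (suc k)) (bounded (suc k)) (suc k) n′) ⟨
    bounded k N + (monomial (w (suc k)) (suc k) S.* bounded (suc k)) N
      ∎
    where
    open import Relation.Binary.Reasoning.Setoid setoid
    N = suc k ℕ.+ n′

  -- Telescoping: by `bounded-suc` the factor of part size `k + 1` turns `bounded (k + 1)` into
  -- `bounded k`, down to `bounded 0`, which is 1.
  bounded-* : ∀ N → bounded N S.* S.Π N (λ j → factor (w (suc j)) (suc j)) S.≈ S.1#
  bounded-* zero    = S.trans (S.*-identityʳ (bounded 0)) bounded-zero
  bounded-* (suc N) = begin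
    bounded (suc N) S.* (P S.* F)  ≈⟨ S.*-congˡ {bounded (suc N)} (S.*-comm P F) ⟩
    bounded (suc N) S.* (F S.* P)  ≈⟨ S.*-assoc (bounded (suc N)) F P ⟨
    bounded (suc N) S.* F S.* P    ≈⟨ S.*-congʳ {P} (S.x≈y+z*x⇒x*[1-z]≈y {z = u} (bounded-suc N)) ⟩
    bounded N S.* P                ≈⟨ bounded-* N ⟩
    S.1#                           ∎
    where
    open ≋-Reasoning
    u = monomial (w (suc N)) (suc N)
    P = S.Π N (λ j → factor (w (suc j)) (suc j))
    F = factor (w (suc N)) (suc N)

  series≈bounded : ∀ {n N} → n ≤ N → series n ≈ bounded N n
  series≈bounded {n} n≤N = reflexive (cong (∑ wt) (boundedPartitions-bound n ℕ.≤-refl n≤N))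

  -- Up to degree `n` no part exceeds `N`, so `series` may be replaced by `bounded N`.
  series-*-truncated : ∀ {n N} → n ≤ N → (series S.* S.Π N (λ j → factor (w (suc j)) (suc j))) n ≈ S.1# n
  series-*-truncated {n} {N} n≤N = trans
    (⊛-cong≤ {f′ = bounded N} {g = P} {g′ = P} n (λ i≤n → series≈bounded (ℕ.≤-trans i≤n n≤N)) (λ _ → refl))
    (bounded-* N n)
    where
    open PowerSeries K using (⊛-cong≤)
    P = S.Π N (λ j → factor (w (suc j)) (suc j))

-- Partitions with restricted gaps, from even partitions to Λ

module GapPartitions where
  open import Data.Nat.Base using (_+_; _*_)
  open ≡ using (refl; sym; trans)

  data Even : ℕ → Set where
    zero : Even 0
    2+_  : ∀ {n} → Even n → Even (2 + n)

  even? : Decidable Even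
  even? 0 = yes zero
  even? 1 = no λ ()
  even? (suc (suc n)) with even? n
  ... | yes e = yes (2+ e)
  ... | no ¬e = no λ { (2+ e) → ¬e e }

  ¬even-suc : ∀ {n} → Even n → ¬ Even (suc n)
  ¬even-suc (2+ e) (2+ e′) = ¬even-suc e e′

  odd⇒even-suc : ∀ {n} → ¬ Even n → Even (suc n)
  odd⇒even-suc {0} ¬e = ⊥-elim (¬e zero)
  odd⇒even-suc {1} ¬e = 2+ zero
  odd⇒even-suc {suc (suc n)} ¬e = 2+ odd⇒even-suc (λ e → ¬e (2+ e))

  largest : List ℕ → ℕ
  largest []      = 0
  largest (x ∷ _) = x

  -- The first i gaps between successive parts (the last one being the gap above 0) differ from 1,
  -- and the remaining gaps are even.  Passing from i to i + 1 allows 3 to be added to the first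
  -- i + 1 parts, which is one part of the conjugate of ν in λ = 2μ + 3ν.
  data Gaps : ℕ → List ℕ → Set where
    evens : ∀ {xs} → All Even xs → Gaps 0 xs
    []    : ∀ {i} → Gaps (suc i) []
    _∷_   : ∀ {i x xs} → x ≢ suc (largest xs) → Gaps i xs → Gaps (suc i) (x ∷ xs)

  gaps? : ∀ i → Decidable (Gaps i)
  gaps? zero    xs with All.all? even? xs
  ... | yes es = yes (evens es)
  ... | no ¬es = no λ { (evens es) → ¬es es }
  gaps? (suc i) []       = yes []
  gaps? (suc i) (x ∷ xs) with ¬? (x ℕ.≟ suc (largest xs)) ×-dec gaps? i xs
  ... | yes (x≢ , g) = yes (x≢ ∷ g)
  ... | no ¬g        = no λ { (x≢ ∷ g) → ¬g (x≢ , g) }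

  -- A missing part counts as 0, so raise i xs has at least i parts.
  raise : ℕ → List ℕ → List ℕ
  raise zero    xs       = xs
  raise (suc i) []       = 3 ∷ raise i []
  raise (suc i) (x ∷ xs) = 3 + x ∷ raise i xs

  -- 0 ∷⁺ xs discards xs; it is meant for a list xs of zeros, that is, for xs = [] when xs is positive.
  infixr 5 _∷⁺_
  _∷⁺_ : ℕ → List ℕ → List ℕ
  zero  ∷⁺ xs = []
  suc x ∷⁺ xs = suc x ∷ xs

  -- A left inverse of `raise` on positive lists, from which the raised partitions are seen to be
  -- distinct.
  lower : ℕ → List ℕ → List ℕ
  lower zero    xs       = xs
  lower (suc i) []       = []
  lower (suc i) (x ∷ xs) = (x ∸ 3) ∷⁺ lower i xs

  Decreasing Positive : List ℕ → Set
  Decreasing = AllPairs _≥_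
  Positive   = All (1 ≤_)

  lower-raise : ∀ i {xs} → Positive xs → lower i (raise i xs) ≡ xs
  lower-raise zero    _         = refl
  lower-raise (suc i) []        = refl
  lower-raise (suc i) {suc x ∷ xs} (_ ∷ pos) = cong (suc x ∷_) (lower-raise i pos)

  sum-raise : ∀ i xs → sum (raise i xs) ≡ i * 3 + sum xs
  sum-raise zero    xs       = refl
  sum-raise (suc i) []       = cong (3 +_) (sum-raise i [])
  sum-raise (suc i) (x ∷ xs) = cong (3 +_) (trans (cong (x +_) (sum-raise i xs)) (x∙yz≈y∙xz x (i * 3) (sum xs)))
    where open import Algebra.Properties.CommutativeSemigroup ℕ.+-commutativeSemigroup using (x∙yz≈y∙xz)

  raise-≤ : ∀ i {k xs} → All (_≤ k) xs → All (_≤ 3 + k) (raise i xs)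
  raise-≤ zero    ≤k        = All.map (λ x≤k → ℕ.≤-trans x≤k (ℕ.m≤n+m _ 3)) ≤k
  raise-≤ (suc i) []        = ℕ.m≤m+n 3 _ ∷ raise-≤ i []
  raise-≤ (suc i) (x≤k ∷ ≤k) = ℕ.+-monoʳ-≤ 3 x≤k ∷ raise-≤ i ≤k

  raise-decreasing : ∀ i {xs} → Decreasing xs → Decreasing (raise i xs)
  raise-decreasing zero    dec          = dec
  raise-decreasing (suc i) []           = raise-≤ i [] ∷ raise-decreasing i []
  raise-decreasing (suc i) (xs≤x ∷ dec) = raise-≤ i xs≤x ∷ raise-decreasing i dec

  raise-positive : ∀ i {xs} → Positive xs → Positive (raise i xs)
  raise-positive zero    pos       = pos
  raise-positive (suc i) []        = s≤s z≤n ∷ raise-positive i []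
  raise-positive (suc i) (_ ∷ pos) = s≤s z≤n ∷ raise-positive i pos

  raise-isPartition : ∀ i {n xs} → IsPartition n xs → IsPartition (i * 3 + n) (raise i xs)
  raise-isPartition i {xs = xs} (isPartition dec pos sums) =
    isPartition (raise-decreasing i dec) (raise-positive i pos) (trans (sum-raise i xs) (cong (i * 3 +_) sums))

  largest-≤⇒all-≤ : ∀ {k xs} → Decreasing xs → largest xs ≤ k → All (_≤ k) xs
  largest-≤⇒all-≤ []         _   = []
  largest-≤⇒all-≤ (≤x ∷ dec) x≤k = x≤k ∷ All.map (λ y≤x → ℕ.≤-trans y≤x x≤k) ≤x

  all-≤⇒largest-≤ : ∀ {k xs} → All (_≤ k) xs → largest xs ≤ k
  all-≤⇒largest-≤ []      = z≤n
  all-≤⇒largest-≤ (≤k ∷ _) = ≤k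

  largest-raise : ∀ i xs → largest (raise (suc i) xs) ≡ 3 + largest xs
  largest-raise i []      = refl
  largest-raise i (_ ∷ _) = refl

  largest-even : ∀ {xs} → All Even xs → Even (largest xs)
  largest-even []      = zero
  largest-even (e ∷ _) = e

  gaps-[] : ∀ i → Gaps i []
  gaps-[] zero    = evens []
  gaps-[] (suc i) = []

  gaps-suc : ∀ i {xs} → Gaps i xs → Gaps (suc i) xs
  gaps-suc zero    (evens [])       = []
  gaps-suc zero    (evens (e ∷ es)) = (λ { refl → ¬even-suc (largest-even es) e }) ∷ evens es
  gaps-suc (suc i) []               = []
  gaps-suc (suc i) (x≢ ∷ g)         = x≢ ∷ gaps-suc i g

  -- Raising the first `i + 1` parts alters only gap number `i + 1`: it was even and becomes odd and
  -- at least 3.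
  gaps-raise : ∀ i {xs} → Decreasing xs → Gaps i xs → Gaps (suc i) (raise (suc i) xs)
  gaps-raise zero    []          (evens [])       = (λ ()) ∷ evens []
  gaps-raise zero    {x ∷ xs} (xs≤x ∷ _) (evens (_ ∷ es)) =
    (λ eq → ℕ.<⇒≢ (s≤s (s≤s (ℕ.m≤n⇒m≤1+n (all-≤⇒largest-≤ xs≤x)))) (sym eq)) ∷ evens es
  gaps-raise (suc i) []          []               = (λ ()) ∷ gaps-raise i [] (gaps-[] i)
  gaps-raise (suc i) {x ∷ xs} (_ ∷ dec) (x≢ ∷ g) =
    (λ eq → x≢ (ℕ.+-cancelˡ-≡ 3 _ _ (trans eq (cong suc (largest-raise i xs))))) ∷ gaps-raise i dec g

  -- Gap number `i + 1` is odd after raising, but `Gaps i` requires it to be even.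
  ¬gaps-raise : ∀ i {xs} → Gaps i xs → ¬ Gaps i (raise (suc i) xs)
  ¬gaps-raise zero    (evens [])      (evens ((2+ ()) ∷ _))
  ¬gaps-raise zero    (evens (e ∷ _)) (evens ((2+ e′) ∷ _)) = ¬even-suc e e′
  ¬gaps-raise (suc i) []              (_ ∷ g)               = ¬gaps-raise i (gaps-[] i) g
  ¬gaps-raise (suc i) (_ ∷ g)         (_ ∷ g′)              = ¬gaps-raise i g g′

  -- The gap `x - h` is odd and not 1, hence at least 3; subtracting 3 leaves an even gap.
  odd-gap : ∀ {h x} → Even h → ¬ Even x → h ≤ x → x ≢ suc h → ∃[ y ] x ≡ 3 + y × Even y × h ≤ y
  odd-gap {x = 0} zero    x-odd _ _   = ⊥-elim (x-odd zero)
  odd-gap {x = 1} zero    _     _ x≢1 = ⊥-elim (x≢1 refl)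
  odd-gap {x = 2} zero    x-odd _ _   = ⊥-elim (x-odd (2+ zero))
  odd-gap {x = suc (suc (suc y))} zero x-odd _ _ with even? y
  ... | yes y-even = y , refl , y-even , z≤n
  ... | no  y-odd  = ⊥-elim (x-odd (2+ odd⇒even-suc y-odd))
  odd-gap (2+ h-even) x-odd (s≤s (s≤s h≤x)) x≢
    with y , refl , y-even , h≤y ← odd-gap h-even (λ x-even → x-odd (2+ x-even)) h≤x (λ eq → x≢ (cong (2 +_) eq))
    = 2 + y , refl , 2+ y-even , s≤s (s≤s h≤y)

  ∷⁺-decreasing : ∀ y {ys} → largest ys ≤ y → Decreasing ys → Decreasing (y ∷⁺ ys)
  ∷⁺-decreasing zero    _    _   = []
  ∷⁺-decreasing (suc y) ys≤y dec = largest-≤⇒all-≤ dec ys≤y ∷ dec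

  ∷⁺-positive : ∀ y {ys} → Positive ys → Positive (y ∷⁺ ys)
  ∷⁺-positive zero    _   = []
  ∷⁺-positive (suc y) pos = s≤s z≤n ∷ pos

  raise-∷⁺ : ∀ i y {ys} → largest ys ≤ y → Positive ys → raise (suc i) (y ∷⁺ ys) ≡ 3 + y ∷ raise i ys
  raise-∷⁺ i (suc y) _   _         = refl
  raise-∷⁺ i zero    _   []        = refl
  raise-∷⁺ i zero    z≤n (() ∷ _)

  -- The parity of gap number `i + 1` decides. If it is even, the list already satisfies `Gaps i`;
  -- missing parts give the even gap 0. If it is odd, it is at least 3, and 3 can be taken from each
  -- of the first `i + 1` parts.
  gaps-suc⁻ : ∀ i {xs} → Decreasing xs → Positive xs → Gaps (suc i) xs →
              Gaps i xs ⊎ ∃[ ys ] Decreasing ys × Positive ys × Gaps i ys × xs ≡ raise (suc i) ys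
  gaps-suc⁻ i _ _ [] = inj₁ (gaps-[] i)
  gaps-suc⁻ zero {x ∷ xs} (xs≤x ∷ dec) (_ ∷ pos) (x≢ ∷ evens es) with even? x
  ... | yes x-even = inj₁ (evens (x-even ∷ es))
  ... | no  x-odd
    with y , refl , y-even , xs≤y ← odd-gap (largest-even es) x-odd (all-≤⇒largest-≤ xs≤x) x≢
    = inj₂ (y ∷⁺ xs , ∷⁺-decreasing y xs≤y dec , ∷⁺-positive y pos , evens (∷⁺-even y y-even)
           , sym (raise-∷⁺ 0 y xs≤y pos))
    where
    ∷⁺-even : ∀ y → Even y → All Even (y ∷⁺ xs)
    ∷⁺-even zero    _ = []
    ∷⁺-even (suc y) e = e ∷ es
  gaps-suc⁻ (suc i) {x ∷ xs} (xs≤x ∷ dec) (_ ∷ pos) (x≢ ∷ g) with gaps-suc⁻ i dec pos g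
  ... | inj₁ g′ = inj₁ (x≢ ∷ g′)
  ... | inj₂ (ys , dec′ , pos′ , g′ , refl)
    -- The tail is a raised list, so `x` is at least `3 + largest ys`; this exhibits `x` as `3 + y`
    -- with `largest ys ≤ y`.
    with s≤s (s≤s (s≤s {n = y} ys≤y)) ← subst (_≤ x) (largest-raise i ys) (all-≤⇒largest-≤ xs≤x)
    = inj₂ (y ∷⁺ ys , ∷⁺-decreasing y ys≤y dec′ , ∷⁺-positive y pos′
           , ∷⁺-gaps y (λ eq → x≢ (trans (cong (3 +_) eq) (cong suc (sym (largest-raise i ys)))))
           , sym (raise-∷⁺ (suc i) y ys≤y pos′))
    where
    ∷⁺-gaps : ∀ y → y ≢ suc (largest ys) → Gaps (suc i) (y ∷⁺ ys)
    ∷⁺-gaps zero    _  = []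
    ∷⁺-gaps (suc y) y≢ = y≢ ∷ g′

  gapPartitions : ℕ → ℕ → List (List ℕ)
  gapPartitions i n = filter (gaps? i) (partitions n)

  ∈-gapPartitions : ∀ {i n xs} → xs ∈ gapPartitions i n ⇔ (IsPartition n xs × Gaps i xs)
  ∈-gapPartitions {i} {n} = mk⇔
    (λ xs∈ → let xs∈′ , g = ∈-filter⁻ (gaps? i) {xs = partitions n} xs∈ in Equivalence.to ∈-partitions xs∈′ , g)
    (λ (p , g) → ∈-filter⁺ (gaps? i) (Equivalence.from ∈-partitions p) g)

  gapPartitions-unique : ∀ i n → Unique (gapPartitions i n)
  gapPartitions-unique i n = Unique.filter⁺ (gaps? i) (partitions-unique n)

  unique∧set⇒↭ : ∀ {xs ys : List (List ℕ)} → Unique xs → Unique ys → (∀ {x} → x ∈ xs ⇔ x ∈ ys) → xs ↭ ys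
  unique∧set⇒↭ u u′ eq = ∼bag⇒↭ (unique∧set⇒bag u u′ eq)

  -- The parity of gap number `i + 1` separates the two summands. The two sides need not be in the
  -- same order, so duplicate-freeness and equal membership are compared instead.
  gapPartitions-suc-≤ : ∀ i n → gapPartitions (suc i) (suc i * 3 + n) ↭
    gapPartitions i (suc i * 3 + n) ++ map (raise (suc i)) (gapPartitions i n)
  gapPartitions-suc-≤ i n = unique∧set⇒↭ (gapPartitions-unique (suc i) N)
    (Unique.++⁺ (gapPartitions-unique i N) unique-raised disjoint) (mk⇔ to from)
    where
    module ∈G {i n xs} = Equivalence (∈-gapPartitions {i} {n} {xs})
    N = suc i * 3 + n

    lowered : map (lower (suc i)) (map (raise (suc i)) (gapPartitions i n)) ≡ gapPartitions i n
    lowered = trans (sym (map-∘ (gapPartitions i n)))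
      (map-id-local (All.tabulate λ xs∈ →
        lower-raise (suc i) (IsPartition.positive (proj₁ (∈G.to {i} {n} xs∈)))))

    unique-raised : Unique (map (raise (suc i)) (gapPartitions i n))
    unique-raised = Unique.map⁻ (subst Unique (sym lowered) (gapPartitions-unique i n))

    disjoint : ∀ {xs} → xs ∈ gapPartitions i N × xs ∈ map (raise (suc i)) (gapPartitions i n) → ⊥
    disjoint (xs∈ , xs∈′) with ys , ys∈ , refl ← ∈-map⁻ (raise (suc i)) xs∈′ =
      ¬gaps-raise i (proj₂ (∈G.to {i} {n} ys∈)) (proj₂ (∈G.to {i} {N} xs∈))

    to : ∀ {xs} → xs ∈ gapPartitions (suc i) N → xs ∈ gapPartitions i N ++ map (raise (suc i)) (gapPartitions i n)
    to xs∈ with p@(isPartition dec pos sums) , g ← ∈G.to {suc i} {N} xs∈ with gaps-suc⁻ i dec pos g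
    ... | inj₁ g′ = ∈-++⁺ˡ (∈G.from {i} {N} (p , g′))
    ... | inj₂ (ys , dec′ , pos′ , g′ , refl) = ∈-++⁺ʳ (gapPartitions i N)
      (∈-map⁺ (raise (suc i)) (∈G.from {i} {n} (isPartition dec′ pos′
        (ℕ.+-cancelˡ-≡ (suc i * 3) _ _ (trans (sym (sum-raise (suc i) ys)) sums)) , g′)))

    from : ∀ {xs} → xs ∈ gapPartitions i N ++ map (raise (suc i)) (gapPartitions i n) → xs ∈ gapPartitions (suc i) N
    from xs∈ with ∈-++⁻ (gapPartitions i N) xs∈
    ... | inj₁ xs∈′ with p , g ← ∈G.to {i} {N} xs∈′ = ∈G.from {suc i} {N} (p , gaps-suc i g)
    ... | inj₂ xs∈′ with ys , ys∈ , refl ← ∈-map⁻ (raise (suc i)) xs∈′ with p , g ← ∈G.to {i} {n} ys∈ =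
      ∈G.from {suc i} {N} (raise-isPartition (suc i) p , gaps-raise i (IsPartition.decreasing p) g)

  -- A raised list has sum at least 3 (i + 1), so none occurs here.
  gapPartitions-suc-< : ∀ i {n} → n < suc i * 3 → gapPartitions (suc i) n ↭ gapPartitions i n
  gapPartitions-suc-< i {n} n< = unique∧set⇒↭ (gapPartitions-unique (suc i) n) (gapPartitions-unique i n)
    (mk⇔ to (λ xs∈ → let p , g = ∈G.to {i} xs∈ in ∈G.from (p , gaps-suc i g)))
    where
    module ∈G {i xs} = Equivalence (∈-gapPartitions {i} {n} {xs})
    to : ∀ {xs} → xs ∈ gapPartitions (suc i) n → xs ∈ gapPartitions i n
    to xs∈ with p@(isPartition dec pos refl) , g ← ∈G.to {suc i} xs∈ with gaps-suc⁻ i dec pos g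
    ... | inj₁ g′ = ∈G.from (p , g′)
    ... | inj₂ (ys , _ , _ , _ , refl) = ⊥-elim (ℕ.<⇒≱ n<
      (subst (suc i * 3 ≤_) (sym (sum-raise (suc i) ys)) (ℕ.m≤m+n (suc i * 3) _)))

  largest-∈ : ∀ {xs} → 1 ≤ largest xs → largest xs ∈ xs
  largest-∈ {_ ∷ _} _ = here refl

  largest-jump : ∀ {m xs} → m ≤ largest xs → largest xs ≤ suc m → m ≢ largest xs → suc m ∈ xs
  largest-jump {m} {xs} m≤h h≤1+m m≢h = subst (_∈ xs) h≡1+m (largest-∈ (subst (1 ≤_) (sym h≡1+m) (s≤s z≤n)))
    where
    h≡1+m : largest xs ≡ suc m
    h≡1+m = ℕ.≤-antisym h≤1+m (ℕ.≤∧≢⇒< m≤h m≢h)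

  inΛ-tail : ∀ {x xs} → InΛ (x ∷ xs) → InΛ xs
  inΛ-tail (1∉ , _ ∷ nc) = 1∉ ∘ there , All.map (_∘ there) nc

  inΛ⇒gaps : ∀ i {xs} → length xs ≤ i → InΛ xs → Gaps i xs
  inΛ⇒gaps i       {[]}         _         _                  = gaps-[] i
  inΛ⇒gaps (suc i) {x ∷ []}     (s≤s len) (1∉ , _)           = (λ { refl → 1∉ (here refl) }) ∷ gaps-[] i
  inΛ⇒gaps (suc i) {x ∷ y ∷ xs} (s≤s len) λ-in@(_ , _ ∷ 1+y∉ ∷ _) =
    (λ { refl → 1+y∉ (here refl) }) ∷ inΛ⇒gaps i len (inΛ-tail λ-in)

  -- `Gaps` looks only at neighbouring parts, Λ at all pairs. If `x = z + 1` for some `z` in `xs`,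
  -- then `largest xs` is `z` or `z + 1`; the gap condition excludes `z`, so `z + 1` already occurs
  -- in `xs`, against the induction hypothesis. The case `z = 0` excludes the part 1.
  gaps⇒inΛ : ∀ {i xs} → length xs ≤ i → Decreasing xs → Positive xs → Gaps i xs → InΛ xs
  gaps⇒inΛ {xs = []} _ _ _ _ = (λ ()) , []
  gaps⇒inΛ {xs = x ∷ xs} (s≤s len) (xs≤x ∷ dec) (_ ∷ pos) (x≢ ∷ g)
    with 1∉ , nc ← gaps⇒inΛ len dec pos g = 1∉x∷xs , suc-x∉ ∷ All.tabulate suc-z∉
    where
    h≤x = all-≤⇒largest-≤ xs≤x
    1∉x∷xs : 1 ∉ x ∷ xs
    1∉x∷xs (there 1∈) = 1∉ 1∈
    1∉x∷xs (here refl) = 1∉ (largest-jump z≤n h≤x (x≢ ∘ cong suc))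
    suc-x∉ : suc x ∉ x ∷ xs
    suc-x∉ (here eq) = ℕ.1+n≢n eq
    suc-x∉ (there x+1∈) = ℕ.1+n≰n (All.lookup xs≤x x+1∈)
    suc-z∉ : ∀ {z} → z ∈ xs → suc z ∉ x ∷ xs
    suc-z∉ z∈ (there z+1∈) = All.lookup nc z∈ z+1∈
    suc-z∉ z∈ (here refl) =
      All.lookup nc z∈ (largest-jump (All.lookup (largest-≤⇒all-≤ dec ℕ.≤-refl) z∈) h≤x (x≢ ∘ cong suc))

open GapPartitions

-- The generating function of Λ as even partitions times ∏ (1 + q³ⁱ)

filter-cong-local : {A : Set a} {P Q : Pred A p} (P? : Decidable P) (Q? : Decidable Q) {xs : List A} →
                    All (λ x → P x ⇔ Q x) xs → filter P? xs ≡ filter Q? xs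
filter-cong-local P? Q? [] = ≡.refl
filter-cong-local P? Q? {x ∷ xs} (e ∷ es) with P? x
... | yes px = ≡.trans (cong (x ∷_) (filter-cong-local P? Q? es)) (≡.sym (filter-accept Q? (Equivalence.to e px)))
... | no ¬px = ≡.trans (filter-cong-local P? Q? es) (≡.sym (filter-reject Q? (¬px ∘ Equivalence.from e)))

all-partitions : ∀ n → All (IsPartition n) (partitions n)
all-partitions n = All.tabulate (Equivalence.to ∈-partitions)

length≤sum : ∀ {xs} → Positive xs → length xs ≤ sum xs
length≤sum []        = z≤n
length≤sum (p ∷ pos) = ℕ.+-mono-≤ p (length≤sum pos)

-- A partition of `n` has at most `n` parts, so `Gaps N` constrains all of its gaps, the one above 0
-- included.
filter-inΛ : ∀ {n N} → n ≤ N → filter inΛ? (partitions n) ≡ gapPartitions N n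
filter-inΛ {n} {N} n≤N = filter-cong-local inΛ? (gaps? N) (All.map equiv (all-partitions n))
  where
  equiv : ∀ {xs} → IsPartition n xs → InΛ xs ⇔ Gaps N xs
  equiv (isPartition dec pos ≡.refl) = mk⇔ (inΛ⇒gaps N len) (gaps⇒inΛ len dec pos)
    where len = ℕ.≤-trans (length≤sum pos) n≤N

module GapSeries (K : CommutativeRing c ℓ) (w : ℕ → CommutativeRing.Carrier K)
  (w[3]≈1 : CommutativeRing._≈_ K (w 3) (CommutativeRing.1# K))
  (w-periodic : ∀ x → CommutativeRing._≈_ K (w (3 ℕ.+ x)) (w x)) where
  open CommutativeRing K hiding (zero)
  open Summation K
  open Truncation K
  open Weighted K w using (wt)
  private module S = SeriesRing K

  -- Periodicity covers the parts already present; `w[3]≈1` covers the parts 3 created from missing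
  -- ones.
  wt-raise : ∀ i xs → wt (raise i xs) ≈ wt xs
  wt-raise zero    xs       = refl
  wt-raise (suc i) []       = trans (*-cong w[3]≈1 (wt-raise i [])) (*-identityˡ 1#)
  wt-raise (suc i) (x ∷ xs) = *-cong (w-periodic x) (wt-raise i xs)

  gapSeries : ℕ → ℕ → Carrier
  gapSeries i n = ∑ wt (gapPartitions i n)

  gapSeries-suc : ∀ i → gapSeries (suc i) S.≈ gapSeries i S.+ monomial 1# (suc i ℕ.* 3) S.* gapSeries i
  gapSeries-suc i n with suc i ℕ.* 3 ℕ.≤? n
  ... | no i≰n = trans (∑-↭ wt (gapPartitions-suc-< i (ℕ.≰⇒> i≰n)))
    (trans (sym (+-identityʳ _)) (+-congˡ (sym (monomial-*-< 1# (gapSeries i) (ℕ.≰⇒> i≰n)))))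
  ... | yes i≤n with n′ ← n ∸ suc i ℕ.* 3 | ≡.refl ← ℕ.m+[n∸m]≡n i≤n = begin
    gapSeries (suc i) N
      ≈⟨ ∑-↭ wt (gapPartitions-suc-≤ i n′) ⟩
    ∑ wt (gapPartitions i N ++ map (raise (suc i)) (gapPartitions i n′))
      ≈⟨ ∑-++ wt (gapPartitions i N) _ ⟩
    gapSeries i N + ∑ wt (map (raise (suc i)) (gapPartitions i n′))
      ≈⟨ +-congˡ (∑-map wt (raise (suc i)) (gapPartitions i n′)) ⟩
    gapSeries i N + ∑ (wt ∘ raise (suc i)) (gapPartitions i n′)
      ≈⟨ +-congˡ (∑-cong (All.universal (wt-raise (suc i)) (gapPartitions i n′))) ⟩
    gapSeries i N + gapSeries i n′
      ≈⟨ +-congˡ (trans (monomial-*-+ 1# (gapSeries i) (suc i ℕ.* 3) n′) (*-identityˡ _)) ⟨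
    gapSeries i N + (monomial 1# (suc i ℕ.* 3) S.* gapSeries i) N
      ∎
    where
    open import Relation.Binary.Reasoning.Setoid setoid
    N = suc i ℕ.* 3 ℕ.+ n′

  gapSeries-Π : ∀ N → gapSeries N S.≈ gapSeries 0 S.* S.Π N (λ j → 1+monomial (suc j ℕ.* 3))
  gapSeries-Π zero    = S.sym (S.*-identityʳ (gapSeries 0))
  gapSeries-Π (suc N) = begin
    gapSeries (suc N)                              ≈⟨ gapSeries-suc N ⟩
    gapSeries N S.+ u S.* gapSeries N              ≈⟨ S.+-congʳ {u S.* gapSeries N} (S.*-identityˡ (gapSeries N)) ⟨
    S.1# S.* gapSeries N S.+ u S.* gapSeries N     ≈⟨ S.distribʳ (gapSeries N) S.1# u ⟨
    (S.1# S.+ u) S.* gapSeries N                   ≈⟨ S.*-comm (S.1# S.+ u) (gapSeries N) ⟩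
    gapSeries N S.* (S.1# S.+ u)                   ≈⟨ S.*-congʳ {S.1# S.+ u} (gapSeries-Π N) ⟩
    gapSeries 0 S.* P S.* (S.1# S.+ u)             ≈⟨ S.*-assoc (gapSeries 0) P (S.1# S.+ u) ⟩
    gapSeries 0 S.* (P S.* (S.1# S.+ u))           ∎
    where
    open ≋-Reasoning
    u = monomial 1# (suc N ℕ.* 3)
    P = S.Π N (λ j → 1+monomial (suc j ℕ.* 3))

  -- Restricting to even parts amounts to giving odd parts weight 0, which yields a sum over all
  -- partitions, as `Weighted` requires.
  gapSeries-zero : (w′ : ℕ → Carrier) → (∀ {x} → Even x → w x ≈ w′ x) → (∀ {x} → ¬ Even x → w′ x ≈ 0#) →
                   gapSeries 0 S.≈ Weighted.series K w′
  gapSeries-zero w′ w≈w′ w′≈0 n = ∑-filter (gaps? 0) (partitions n) wt≈wt′ wt′≈0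
    where
    wt′ = Weighted.wt K w′
    wt≈wt′ : ∀ xs → Gaps 0 xs → wt xs ≈ wt′ xs
    wt≈wt′ []       _                = refl
    wt≈wt′ (x ∷ xs) (evens (e ∷ es)) = *-cong (w≈w′ e) (wt≈wt′ xs (evens es))
    wt′≈0 : ∀ xs → ¬ Gaps 0 xs → wt′ xs ≈ 0#
    wt′≈0 xs ¬g = Weighted.wt-zero K w′ (Any.map w′≈0 (¬All⇒Any¬ even? xs (¬g ∘ evens)))

-- The common denominator of the two generating functions

module ProductFormulas (K : CommutativeRing c ℓ) (α γ : CommutativeRing.Carrier K) where
  open CommutativeRing K hiding (zero)
  open PowerSeries K using (⊛-cong≤)
  open Summation K
  open Truncation K
  private module S = SeriesRing K

  residueWeight₃ : ℕ → Carrier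
  residueWeight₃ 1 = γ
  residueWeight₃ 2 = α
  residueWeight₃ _ = 1#

  -- β = 0 selects the even parts, β = 1 the parts counted by B₁.
  residueWeight₆ : Carrier → ℕ → Carrier
  residueWeight₆ β 1 = 0#
  residueWeight₆ β 2 = α
  residueWeight₆ β 3 = β
  residueWeight₆ β 4 = γ
  residueWeight₆ β 5 = 0#
  residueWeight₆ β _ = 1#

  weight₃ : ℕ → Carrier
  weight₃ x = residueWeight₃ (x % 3)

  weight₆ : Carrier → ℕ → Carrier
  weight₆ β x = residueWeight₆ β (x % 6)

  -- For even numbers the residues 0, 1, 2 mod 3 are the residues 0, 4, 2 mod 6; hence γ belongs to
  -- 1 mod 3 and to 4 mod 6.
  weight₃-even : ∀ {x} → Even x → weight₃ x ≈ weight₆ 0# x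
  weight₃-even zero                  = refl
  weight₃-even (2+ zero)             = refl
  weight₃-even (2+ (2+ zero))        = refl
  weight₃-even (2+ (2+ (2+ x-even))) = weight₃-even x-even

  weight₆-odd : ∀ {x} → ¬ Even x → weight₆ 0# x ≈ 0#
  weight₆-odd {0} ¬e = ⊥-elim (¬e zero)
  weight₆-odd {1} ¬e = refl
  weight₆-odd {2} ¬e = ⊥-elim (¬e (2+ zero))
  weight₆-odd {3} ¬e = refl
  weight₆-odd {4} ¬e = ⊥-elim (¬e (2+ (2+ zero)))
  weight₆-odd {5} ¬e = refl
  weight₆-odd {suc (suc (suc (suc (suc (suc x)))))} ¬e = weight₆-odd {x} (λ e → ¬e (2+ (2+ (2+ e))))

  weight₆-periodic : ∀ β r i → weight₆ β (r ℕ.+ i ℕ.* 6) ≈ weight₆ β r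
  weight₆-periodic β r i = reflexive (cong (residueWeight₆ β) ([m+kn]%n≡m%n r i 6))

  factor-0 : ∀ m → factor 0# m S.≈ S.1#
  factor-0 m = begin
    S.1# S.+ S.- monomial 0# m    ≈⟨ S.+-congˡ {S.1#} (S.-‿cong (monomial-0 m)) ⟩
    S.1# S.+ S.- S.0#             ≈⟨ S.+-congˡ {S.1#} (λ _ → -0#≈0#) ⟩
    S.1# S.+ S.0#                 ≈⟨ S.+-identityʳ S.1# ⟩
    S.1#                          ∎
    where
    open ≋-Reasoning
    open import Algebra.Properties.Ring ring using (-0#≈0#)
    monomial-0 : ∀ m → monomial 0# m S.≈ S.0#
    monomial-0 zero    zero    = refl
    monomial-0 zero    (suc n) = refl
    monomial-0 (suc m) zero    = refl
    monomial-0 (suc m) (suc n) = monomial-0 m n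

  -- Factor number `j` of (a qᵈ; qᵉ)∞.
  F : Carrier → ℕ → ℕ → ℕ → ℕ → Carrier
  F a d e j = factor a (d ℕ.+ j ℕ.* e)

  -- The part sizes up to 6N are grouped by residue mod 6; residues 1 and 5 have weight 0 and
  -- contribute trivial factors.
  Π-weight₆ : ∀ β N → S.Π (N ℕ.* 6) (λ j → factor (weight₆ β (suc j)) (suc j)) S.≈
    S.Π N (λ i → F α 2 6 i S.* F β 3 6 i S.* F γ 4 6 i S.* F 1# 6 6 i)
  Π-weight₆ β N = S.trans (S.Π-group₆ N f) (S.Π-cong N group)
    where
    f : ℕ → ℕ → Carrier
    f j = factor (weight₆ β (suc j)) (suc j)
    f≈ : ∀ r i → f (r ℕ.+ i ℕ.* 6) S.≈ F (weight₆ β (suc r)) (suc r) 6 i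
    f≈ r i = factor-cong (weight₆-periodic β (suc r) i) (suc r ℕ.+ i ℕ.* 6)
    group : ∀ i → let j = i ℕ.* 6 in
      f j S.* f (1 ℕ.+ j) S.* f (2 ℕ.+ j) S.* f (3 ℕ.+ j) S.* f (4 ℕ.+ j) S.* f (5 ℕ.+ j) S.≈
      F α 2 6 i S.* F β 3 6 i S.* F γ 4 6 i S.* F 1# 6 6 i
    group i = S.*-cong
      (S.trans (S.*-cong
        (S.*-cong (S.*-cong (S.trans (S.*-cong (S.trans (f≈ 0 i) (factor-0 (1 ℕ.+ i ℕ.* 6))) (f≈ 1 i))
                                     (S.*-identityˡ (F α 2 6 i)))
                            (f≈ 2 i))
                  (f≈ 3 i))
        (S.trans (f≈ 4 i) (factor-0 (5 ℕ.+ i ℕ.* 6))))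
        (S.*-identityʳ (F α 2 6 i S.* F β 3 6 i S.* F γ 4 6 i)))
      (f≈ 5 i)

  -- Two lengths are needed: for B₁ the factors of (q³;q³)∞ are taken in pairs, so M = 2N, while for
  -- Λ each of them meets one factor 1 + q³ʲ, so M = N.
  truncated : ℕ → ℕ → ℕ → Carrier
  truncated M N = S.Π M (F 1# 3 3) S.* S.Π N (F α 2 6) S.* S.Π N (F γ 4 6)

  n<N⇒n≤N*6 : ∀ {n N} → n < N → n ≤ N ℕ.* 6
  n<N⇒n≤N*6 {N = N} n<N = ℕ.≤-trans (ℕ.<⇒≤ n<N) (ℕ.m≤m*n N 6)

  lambdaSeries : ℕ → Carrier
  lambdaSeries n = ∑ (Weighted.wt K weight₃) (filter inΛ? (partitions n))

  module _ {p₃ pα pγ : ℕ → Carrier} (p₃≈ : TruncatesTo p₃ 1# 3 3)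
           (pα≈ : TruncatesTo pα α 2 6) (pγ≈ : TruncatesTo pγ γ 4 6) where

    denominator : ℕ → Carrier
    denominator = p₃ S.* pα S.* pγ

    denominator-truncated : ∀ {M N n} → n < M → n < N → denominator n ≈ truncated M N n
    denominator-truncated {M} {N} {n} n<M n<N =
      ⊛-cong≤ {f = p₃ S.* pα} {f′ = S.Π M (F 1# 3 3) S.* S.Π N (F α 2 6)} {g = pγ} n
        (λ {i} i≤n → ⊛-cong≤ {f = p₃} {g = pα} i
          (λ j≤i → truncation p₃≈ (ℕ.≤-<-trans (ℕ.≤-trans j≤i i≤n) n<M))
          (λ j≤i → truncation pα≈ (ℕ.≤-<-trans (ℕ.≤-trans j≤i i≤n) n<N)))
        (λ i≤n → truncation pγ≈ (ℕ.≤-<-trans i≤n n<N))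

    weightedSeries₆-* : Weighted.series K (weight₆ 1#) S.* denominator S.≈ S.1#
    weightedSeries₆-* n = begin
      (G S.* denominator) n
        ≈⟨ ⊛-cong≤ {f = G} {g = denominator} {g′ = truncated (N ℕ.* 2) N} n (λ _ → refl)
             (λ i≤n → denominator-truncated (ℕ.≤-<-trans i≤n (ℕ.<-≤-trans (ℕ.n<1+n n) (ℕ.m≤m*n N 2))) (s≤s i≤n)) ⟩
      (G S.* truncated (N ℕ.* 2) N) n
        ≈⟨ S.*-congˡ {G} (S.trans regroup (S.sym (Π-weight₆ 1# N))) n ⟩
      (G S.* S.Π (N ℕ.* 6) (λ j → factor (weight₆ 1# (suc j)) (suc j))) n
        ≈⟨ Weighted.series-*-truncated K (weight₆ 1#) (n<N⇒n≤N*6 (ℕ.n<1+n n)) ⟩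
      S.1# n
        ∎
      where
      open import Relation.Binary.Reasoning.Setoid setoid
      N = suc n
      G = Weighted.series K (weight₆ 1#)
      -- Alternate factors separate (q³;q³)∞ into (q³;q⁶)∞ and (q⁶;q⁶)∞, the parts 3 and 0 mod 6.
      pair : ∀ i → F 1# 3 3 (i ℕ.* 2) S.* F 1# 3 3 (1 ℕ.+ i ℕ.* 2) S.≈ F 1# 3 6 i S.* F 1# 6 6 i
      pair i = S.reflexive (cong (λ m → factor 1# (3 ℕ.+ m) S.* factor 1# (6 ℕ.+ m)) (ℕ.*-assoc i 2 3))
      regroup : truncated (N ℕ.* 2) N S.≈ S.Π N (λ i → F α 2 6 i S.* F 1# 3 6 i S.* F γ 4 6 i S.* F 1# 6 6 i)
      regroup = S.trans
        (S.*-congʳ {S.Π N (F γ 4 6)} (S.*-congʳ {S.Π N (F α 2 6)}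
          (S.trans (S.Π-group₂ N (F 1# 3 3)) (S.Π-cong N pair))))
        (S.trans (S.Π-*₃ N (λ i → F 1# 3 6 i S.* F 1# 6 6 i) (F α 2 6) (F γ 4 6))
                 (S.Π-cong N (λ i → S.stac≈asct (F 1# 3 6 i) (F 1# 6 6 i) (F α 2 6 i) (F γ 4 6 i))))

    lambdaSeries-* : lambdaSeries S.* denominator S.≈ S.1#
    lambdaSeries-* n = begin
      (lambdaSeries S.* denominator) n
        ≈⟨ ⊛-cong≤ {f = lambdaSeries} {f′ = gapSeries N} {g = denominator} {g′ = truncated N N} n
             (λ i≤n → reflexive (cong (∑ (Weighted.wt K weight₃)) (filter-inΛ (ℕ.m≤n⇒m≤1+n i≤n))))
             (λ i≤n → denominator-truncated (s≤s i≤n) (s≤s i≤n)) ⟩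
      (gapSeries N S.* truncated N N) n
        ≈⟨ S.*-congʳ {truncated N N} (S.trans (gapSeries-Π N)
             (S.*-congʳ {D} (gapSeries-zero (weight₆ 0#) weight₃-even (λ {x} → weight₆-odd {x})))) n ⟩
      (E S.* D S.* truncated N N) n
        ≈⟨ S.xd∙pac≈x∙dpac E D (S.Π N (F 1# 3 3)) (S.Π N (F α 2 6)) (S.Π N (F γ 4 6)) n ⟩
      (E S.* (D S.* S.Π N (F 1# 3 3) S.* S.Π N (F α 2 6) S.* S.Π N (F γ 4 6))) n
        ≈⟨ S.*-congˡ {E} (S.trans regroup (S.sym (Π-weight₆ 0# N))) n ⟩
      (E S.* S.Π (N ℕ.* 6) (λ j → factor (weight₆ 0# (suc j)) (suc j))) n
        ≈⟨ Weighted.series-*-truncated K (weight₆ 0#) (n<N⇒n≤N*6 (ℕ.n<1+n n)) ⟩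
      S.1# n
        ∎
      where
      open import Relation.Binary.Reasoning.Setoid setoid
      open GapSeries K weight₃ refl (λ _ → refl)
      N = suc n
      E = Weighted.series K (weight₆ 0#)
      D = S.Π N (λ j → 1+monomial (suc j ℕ.* 3))
      pair : ∀ j → 1+monomial (suc j ℕ.* 3) S.* F 1# 3 3 j S.≈ F 1# 6 6 j
      pair j = S.trans (1+monomial-*-factor (suc j ℕ.* 3))
        (S.reflexive (cong (factor 1#) (≡.sym (ℕ.*-distribˡ-+ (suc j) 3 3))))
      regroup : D S.* S.Π N (F 1# 3 3) S.* S.Π N (F α 2 6) S.* S.Π N (F γ 4 6) S.≈
                S.Π N (λ i → F α 2 6 i S.* F 0# 3 6 i S.* F γ 4 6 i S.* F 1# 6 6 i)
      regroup = S.trans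
        (S.*-congʳ {S.Π N (F γ 4 6)} (S.*-congʳ {S.Π N (F α 2 6)}
          (S.trans (S.Π-* N (λ j → 1+monomial (suc j ℕ.* 3)) (F 1# 3 3)) (S.Π-cong N pair))))
        (S.trans (S.Π-*₃ N (F 1# 6 6) (F α 2 6) (F γ 4 6))
          -- The inserted unit becomes the factor of residue 3, which is trivial because β = 0.
          (S.Π-cong N (λ i → S.trans (S.uac≈aεcu (F 1# 6 6 i) (F α 2 6 i) (F γ 4 6 i))
            (S.*-congʳ {F 1# 6 6 i} (S.*-congʳ {F γ 4 6 i} (S.*-congˡ {F α 2 6 i}
              (S.sym (factor-0 (3 ℕ.+ i ℕ.* 6)))))))))

    lambdaSeries≈weightedSeries₆ : lambdaSeries S.≈ Weighted.series K (weight₆ 1#)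
    lambdaSeries≈weightedSeries₆ = S.inverse-unique denominator lambdaSeries-* weightedSeries₆-*

-- Coefficients of AᵐCⁿ as partition counts

open import Data.Integer.Base using (+_)
open ≡ using (refl)

#parts-accept : ∀ {r k x} .{{_ : NonZero k}} xs →
                x % k ≡ r → (#parts≡ r mod k) (x ∷ xs) ≡ suc ((#parts≡ r mod k) xs)
#parts-accept {r} {k} xs eq = cong length (filter-accept (λ x → x % k ℕ.≟ r) {xs = xs} eq)

#parts-reject : ∀ {r k x} .{{_ : NonZero k}} xs →
                x % k ≢ r → (#parts≡ r mod k) (x ∷ xs) ≡ (#parts≡ r mod k) xs
#parts-reject {r} {k} xs neq = cong length (filter-reject (λ x → x % k ℕ.≟ r) {xs = xs} neq)

module WeightAsMonomial (K : CommutativeRing c ℓ) (α γ : CommutativeRing.Carrier K)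
  {r s k : ℕ} (r≢s : r ≢ s) .{{_ : NonZero k}} where
  private module K = CommutativeRing K
  open import Algebra.Properties.Semiring.Exp K.semiring using () renaming (_^_ to _**_)

  data ResidueWeight (v : ℕ → K.Carrier) (j : ℕ) : Set ℓ where
    weight-α : j ≡ r → v j K.≈ α → ResidueWeight v j
    weight-γ : j ≡ s → v j K.≈ γ → ResidueWeight v j
    weight-1 : j ≢ r → j ≢ s → v j K.≈ K.1# → ResidueWeight v j

  -- Trades the counts in the exponents for one weight per part, the form used by `Weighted`. It
  -- serves residues 2, 1 mod 3 and residues 2, 4 mod 6.
  monomial≈wt : ∀ v {xs} → All (λ x → ResidueWeight v (x % k)) xs →
    α ** (#parts≡ r mod k) xs K.* γ ** (#parts≡ s mod k) xs K.≈ Weighted.wt K (λ x → v (x % k)) xs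
  monomial≈wt v [] = K.*-identityˡ _
  monomial≈wt v {x ∷ xs} (weight-α refl v≈α ∷ ws)
    rewrite #parts-accept {x % k} {k} {x} xs refl | #parts-reject {s} {k} {x} xs r≢s =
    K.trans (K.*-assoc _ _ _) (K.*-cong (K.sym v≈α) (monomial≈wt v ws))
  monomial≈wt v {x ∷ xs} (weight-γ refl v≈γ ∷ ws)
    rewrite #parts-accept {x % k} {k} {x} xs refl | #parts-reject {r} {k} {x} xs (r≢s ∘ ≡.sym) =
    K.trans (x∙yz≈y∙xz _ _ _) (K.*-cong (K.sym v≈γ) (monomial≈wt v ws))
    where open import Algebra.Properties.CommutativeSemigroup K.*-commutativeSemigroup using (x∙yz≈y∙xz)
  monomial≈wt v {x ∷ xs} (weight-1 ≢r ≢s v≈1 ∷ ws)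
    rewrite #parts-reject {r} {k} {x} xs ≢r | #parts-reject {s} {k} {x} xs ≢s =
    K.trans (K.sym (K.*-identityˡ _)) (K.*-cong (K.sym v≈1) (monomial≈wt v ws))

open import Defs using (_*_; _^_; _≈_; 1#; Carrier; A; C; q)

ℤ⟦A⟧-ring ℤ⟦A,C⟧-ring : CommutativeRing _ _
ℤ⟦A⟧-ring = PowerSeries.powerSeriesRing ℤ.+-*-commutativeRing
ℤ⟦A,C⟧-ring = PowerSeries.powerSeriesRing ℤ⟦A⟧-ring

private
  module K = CommutativeRing ℤ⟦A,C⟧-ring
  module S = SeriesRing ℤ⟦A,C⟧-ring

open Summation ℤ⟦A,C⟧-ring
open ProductFormulas ℤ⟦A,C⟧-ring Coeff.A Coeff.C

-- ℤ⟦A,C⟧ is ℤ⟦A⟧⟦C⟧, so the coefficient of AⁱCʲ in f is f j i.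
AC-monomial : ℕ → ℕ → Coeff.Carrier
AC-monomial i j = Coeff.A Coeff.^ i Coeff.* Coeff.C Coeff.^ j

module _ where
  private
    module Q₁ = Truncation ℤ.+-*-commutativeRing
    module Q₂ = Truncation ℤ⟦A⟧-ring

  AC-monomial≈ : ∀ i j → AC-monomial i j K.≈ Q₂.monomial (Q₁.monomial (+ 1) i) j
  AC-monomial≈ i j = K.trans
    (K.*-cong (K.trans (Q₂.constant-^ (X _) i) (Q₂.monomial-cong (Q₁.X^≈monomial i) 0)) (Q₂.X^≈monomial j))
    (Q₂.monomial-1-* (Q₁.monomial (+ 1) i) 0 j)

  AC-monomial-diagonal : ∀ i j → AC-monomial i j j i ≡ + 1
  AC-monomial-diagonal i j = ≡.trans (AC-monomial≈ i j j i)
    (≡.trans (Q₂.monomial-diagonal (Q₁.monomial (+ 1) i) j i) (Q₁.monomial-diagonal (+ 1) i))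

  AC-monomial-off-diagonal : ∀ {i j m₁ m₂} → ¬ (i ≡ m₁ × j ≡ m₂) → AC-monomial i j m₂ m₁ ≡ + 0
  AC-monomial-off-diagonal {i} {j} {m₁} {m₂} ≢m with j ℕ.≟ m₂
  ... | no j≢m₂ = ≡.trans (AC-monomial≈ i j m₂ m₁) (Q₂.monomial-off-diagonal (Q₁.monomial (+ 1) i) j≢m₂ m₁)
  ... | yes refl = ≡.trans (AC-monomial≈ i j j m₁) (≡.trans (Q₂.monomial-diagonal (Q₁.monomial (+ 1) i) j m₁)
    (Q₁.monomial-off-diagonal (+ 1) (λ i≡m₁ → ≢m (i≡m₁ , refl))))

-- Each monomial contributes 1 if its exponents are `m₁` and `m₂`, and 0 otherwise, so the
-- coefficient is a count.
∑-coefficient : {A : Set a} {P Q : Pred A p} (P? : Decidable P) (Q? : Decidable Q) (f g : A → ℕ) (m₁ m₂ : ℕ)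
  {xs : List A} → All (λ x → P x ⇔ (Q x × f x ≡ m₁ × g x ≡ m₂)) xs →
  ∑ (λ x → AC-monomial (f x) (g x)) (filter Q? xs) m₂ m₁ ≡ + length (filter P? xs)
∑-coefficient P? Q? f g m₁ m₂ [] = refl
∑-coefficient P? Q? f g m₁ m₂ {x ∷ xs} (e ∷ es) with P? x | Q? x
... | yes px | no ¬qx = ⊥-elim (¬qx (proj₁ (Equivalence.to e px)))
... | no ¬px | no ¬qx = ∑-coefficient P? Q? f g m₁ m₂ es
... | yes px | yes qx with _ , refl , refl ← Equivalence.to e px =
  cong₂ ℤ._+_ (AC-monomial-diagonal (f x) (g x)) (∑-coefficient P? Q? f g m₁ m₂ es)
... | no ¬px | yes qx = ≡.trans (cong₂ ℤ._+_
  (AC-monomial-off-diagonal {f x} {g x} (λ eqs → ¬px (Equivalence.from e (qx , eqs))))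
  (∑-coefficient P? Q? f g m₁ m₂ es))
  (ℤ.+-identityˡ _)

Λ-series≈lambdaSeries : Λ-series S.≈ lambdaSeries
Λ-series≈lambdaSeries n = ∑-cong (All.universal (λ xs → monomial≈wt residueWeight₃
  (All.universal (λ x → classify (m%n<n x 3)) xs)) (filter inΛ? (partitions n)))
  where
  open WeightAsMonomial ℤ⟦A,C⟧-ring Coeff.A Coeff.C {2} {1} {3} (λ ())
  classify : ∀ {j} → j < 3 → ResidueWeight residueWeight₃ j
  classify {0} _ = weight-1 (λ ()) (λ ()) K.refl
  classify {1} _ = weight-γ refl K.refl
  classify {2} _ = weight-α refl K.refl
  classify {suc (suc (suc _))} (s≤s (s≤s (s≤s ())))

Λ-series-coefficient : ∀ n m₁ m₂ → Λ-series n m₂ m₁ ≡ + B₂ m₁ m₂ n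
Λ-series-coefficient n m₁ m₂ = ∑-coefficient (isB₂? m₁ m₂) inΛ? (#parts≡ 2 mod 3) (#parts≡ 1 mod 3) m₁ m₂
  (All.map equiv (all-partitions n))
  where
  equiv : ∀ {xs} → IsPartition n xs → IsB₂ m₁ m₂ xs ⇔
          (InΛ xs × (#parts≡ 2 mod 3) xs ≡ m₁ × (#parts≡ 1 mod 3) xs ≡ m₂)
  equiv (isPartition _ pos _) = mk⇔
    (λ (nc , 2≤ , eq₂ , eq₁) → ((λ 1∈ → ℕ.1+n≰n (All.lookup 2≤ 1∈)) , nc) , eq₁ , eq₂)
    (λ ((1∉ , nc) , eq₁ , eq₂) → nc
      , All.tabulate (λ x∈ → ℕ.≤∧≢⇒< (All.lookup pos x∈) (λ { refl → 1∉ x∈ })) , eq₂ , eq₁)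

Allowed : ℕ → Set
Allowed x = x % 6 ∈ 0 ∷ 2 ∷ 3 ∷ 4 ∷ []

allAllowed? : Decidable (All Allowed)
allAllowed? = All.all? (λ x → x % 6 ∈? _)

allowedSeries : Carrier
allowedSeries n = ∑ (λ xs → AC-monomial ((#parts≡ 2 mod 6) xs) ((#parts≡ 4 mod 6) xs))
                    (filter allAllowed? (partitions n))

allowedSeries-coefficient : ∀ n m₁ m₂ → allowedSeries n m₂ m₁ ≡ + B₁ m₁ m₂ n
allowedSeries-coefficient n m₁ m₂ =
  ∑-coefficient (isB₁? m₁ m₂) allAllowed? (#parts≡ 2 mod 6) (#parts≡ 4 mod 6) m₁ m₂
    (All.universal (λ _ → mk⇔ id id) (partitions n))

allowedSeries≈weightedSeries₆ : allowedSeries S.≈ Weighted.series ℤ⟦A,C⟧-ring (weight₆ K.1#)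
allowedSeries≈weightedSeries₆ n = ∑-filter allAllowed?
  {λ xs → AC-monomial ((#parts≡ 2 mod 6) xs) ((#parts≡ 4 mod 6) xs)}
  {Weighted.wt ℤ⟦A,C⟧-ring (weight₆ K.1#)} (partitions n)
  (λ xs good → monomial≈wt (residueWeight₆ K.1#) (All.map classify good)) wt≈0
  where
  open WeightAsMonomial ℤ⟦A,C⟧-ring Coeff.A Coeff.C {2} {4} {6} (λ ())
  classify : ∀ {j} → j ∈ 0 ∷ 2 ∷ 3 ∷ 4 ∷ [] → ResidueWeight (residueWeight₆ K.1#) j
  classify (here refl)                         = weight-1 (λ ()) (λ ()) K.refl
  classify (there (here refl))                 = weight-α refl K.refl
  classify (there (there (here refl)))         = weight-1 (λ ()) (λ ()) K.refl
  classify (there (there (there (here refl)))) = weight-γ refl K.refl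

  disallowed : ∀ {j} → j < 6 → j ∉ 0 ∷ 2 ∷ 3 ∷ 4 ∷ [] → residueWeight₆ K.1# j K.≈ K.0#
  disallowed {0} _ ∉ = ⊥-elim (∉ (here refl))
  disallowed {1} _ ∉ = K.refl
  disallowed {2} _ ∉ = ⊥-elim (∉ (there (here refl)))
  disallowed {3} _ ∉ = ⊥-elim (∉ (there (there (here refl))))
  disallowed {4} _ ∉ = ⊥-elim (∉ (there (there (there (here refl)))))
  disallowed {5} _ ∉ = K.refl
  disallowed {suc (suc (suc (suc (suc (suc _)))))} (s≤s (s≤s (s≤s (s≤s (s≤s (s≤s ())))))) _

  wt≈0 : ∀ xs → ¬ All Allowed xs → Weighted.wt ℤ⟦A,C⟧-ring (weight₆ K.1#) xs K.≈ K.0#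
  wt≈0 xs ¬allowed = Weighted.wt-zero ℤ⟦A,C⟧-ring (weight₆ K.1#)
    (Any.map (λ {x} → disallowed (m%n<n x 6)) (¬All⇒Any¬ (λ x → x % 6 ∈? _) xs ¬allowed))

-- The Pochhammer products of the statement

private module T = Truncation ℤ⟦A,C⟧-ring

-- By refl this would take too long to check; at a variable N the two products are stuck and their
-- rings are compared directly.
⟨⨾⟩∞≡pochhammer∞ : ∀ a b n → ⟨ a ⨾ b ⟩∞ n ≡ pochhammer∞ K.rawRing a b n
⟨⨾⟩∞≡pochhammer∞ a b n = begin
  ⟨ a ⨾ b ⟩∞ n                       ≡⟨⟩
  pochhammer ℤ⟦A,C⟧ a b (suc n) n    ≡⟨ cong (λ f → f n) (ring-irrelevant (suc n)) ⟩
  pochhammer K.rawRing a b (suc n) n ≡⟨⟩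
  pochhammer∞ K.rawRing a b n        ∎
  where
  open ≡.≡-Reasoning
  ring-irrelevant : ∀ N → pochhammer ℤ⟦A,C⟧ a b N ≡ pochhammer K.rawRing a b N
  ring-irrelevant N = refl

-- IsMonomial and InverseOfProduct are records and not synonyms: a synonym would be unfolded, and
-- comparing the unfolded coefficients of concrete series is prohibitively slow.
record IsMonomial (f : Carrier) (x : Coeff.Carrier) (m : ℕ) : Set where
  constructor isMonomial
  field
    ≈monomial : f S.≈ T.monomial x m
open IsMonomial

q^-isMonomial : ∀ n → IsMonomial (q ^ n) K.1# n
q^-isMonomial n = isMonomial (T.X^≈monomial n)

constant*q^-isMonomial : ∀ x n → IsMonomial (constant ℤ⟦A,C⟧ x * q ^ n) x n
constant*q^-isMonomial x n = isMonomial (T.constant*X^≈monomial x n)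

⟨⨾⟩∞-truncates : ∀ {a b} x d e → IsMonomial a x (suc d) → IsMonomial b K.1# (suc e) →
                 T.TruncatesTo ⟨ a ⨾ b ⟩∞ x (suc d) (suc e)
⟨⨾⟩∞-truncates {a} {b} x d e a≈ b≈ = T.truncatesTo λ {N} {n} n<N → K.trans
  {⟨ a ⨾ b ⟩∞ n} {pochhammer∞ K.rawRing a b n} {S.Π N (λ j → T.factor x (suc d ℕ.+ j ℕ.* suc e)) n}
  (K.reflexive (⟨⨾⟩∞≡pochhammer∞ a b n))
  (T.truncation (T.pochhammer∞-truncates x d e (≈monomial a≈) (≈monomial b≈)) n<N)

q³-truncates : T.TruncatesTo ⟨ q ^ 3 ⨾ q ^ 3 ⟩∞ K.1# 3 3
q³-truncates = ⟨⨾⟩∞-truncates {q ^ 3} {q ^ 3} K.1# 2 2 (q^-isMonomial 3) (q^-isMonomial 3)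

Aq²-truncates : T.TruncatesTo ⟨ A * q ^ 2 ⨾ q ^ 6 ⟩∞ Coeff.A 2 6
Aq²-truncates = ⟨⨾⟩∞-truncates {A * q ^ 2} {q ^ 6} Coeff.A 1 5
  (constant*q^-isMonomial Coeff.A 2) (q^-isMonomial 6)

Cq⁴-truncates : T.TruncatesTo ⟨ C * q ^ 4 ⨾ q ^ 6 ⟩∞ Coeff.C 4 6
Cq⁴-truncates = ⟨⨾⟩∞-truncates {C * q ^ 4} {q ^ 6} Coeff.C 3 5
  (constant*q^-isMonomial Coeff.C 4) (q^-isMonomial 6)

-- The three factors are variables, so they stay opaque; the concrete products are substituted only
-- in `pochhammers-inverse`.
Λ-series-* : ∀ {p₃ pα pγ} → T.TruncatesTo p₃ K.1# 3 3 →
             T.TruncatesTo pα Coeff.A 2 6 → T.TruncatesTo pγ Coeff.C 4 6 →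
             Λ-series * (p₃ * pα * pγ) ≈ 1#
Λ-series-* {p₃} {pα} {pγ} p₃≈ pα≈ pγ≈ = S.trans
  {Λ-series S.* D} {lambdaSeries S.* D} {S.1#}
  (S.*-congʳ {D} {Λ-series} {lambdaSeries} Λ-series≈lambdaSeries) (lambdaSeries-* p₃≈ pα≈ pγ≈)
  where D = p₃ S.* pα S.* pγ

record InverseOfProduct (f p₁ p₂ p₃ : Carrier) : Set where
  field
    inverse : f * (p₁ * p₂ * p₃) ≈ 1#

Λ-series-inverse : ∀ {p₃ pα pγ} → T.TruncatesTo p₃ K.1# 3 3 →
                   T.TruncatesTo pα Coeff.A 2 6 → T.TruncatesTo pγ Coeff.C 4 6 →
                   InverseOfProduct Λ-series p₃ pα pγ
Λ-series-inverse p₃≈ pα≈ pγ≈ = record { inverse = Λ-series-* p₃≈ pα≈ pγ≈ }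

pochhammers-inverse : InverseOfProduct Λ-series ⟨ q ^ 3 ⨾ q ^ 3 ⟩∞ ⟨ A * q ^ 2 ⨾ q ^ 6 ⟩∞ ⟨ C * q ^ 4 ⨾ q ^ 6 ⟩∞
pochhammers-inverse = Λ-series-inverse q³-truncates Aq²-truncates Cq⁴-truncates

lambdaSeries≈allowedSeries : lambdaSeries S.≈ allowedSeries
lambdaSeries≈allowedSeries = S.trans {lambdaSeries} {Weighted.series ℤ⟦A,C⟧-ring (weight₆ K.1#)} {allowedSeries}
  (lambdaSeries≈weightedSeries₆ q³-truncates Aq²-truncates Cq⁴-truncates)
  (S.sym {allowedSeries} allowedSeries≈weightedSeries₆)

B₁≡B₂ : ∀ n m₁ m₂ → B₁ m₁ m₂ n ≡ B₂ m₁ m₂ n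
B₁≡B₂ n m₁ m₂ = ℤ.+-injective (begin
  + B₁ m₁ m₂ n          ≡⟨ allowedSeries-coefficient n m₁ m₂ ⟨
  allowedSeries n m₂ m₁ ≡⟨ lambdaSeries≈allowedSeries n m₂ m₁ ⟨
  lambdaSeries n m₂ m₁  ≡⟨ Λ-series≈lambdaSeries n m₂ m₁ ⟨
  Λ-series n m₂ m₁      ≡⟨ Λ-series-coefficient n m₁ m₂ ⟩
  + B₂ m₁ m₂ n          ∎)
  where open ≡.≡-Reasoning

theorem3p1 : ((n m₁ m₂ : ℕ) → B₁ m₁ m₂ n ≡ B₂ m₁ m₂ n)
    × (Λ-series * (⟨ q ^ 3 ⨾ q ^ 3 ⟩∞ * ⟨ A * q ^ 2 ⨾ q ^ 6 ⟩∞ * ⟨ C * q ^ 4 ⨾ q ^ 6 ⟩∞) ≈ 1#)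
theorem3p1 = B₁≡B₂ , InverseOfProduct.inverse pochhammers-inverse
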